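{- Let $n=p^\alpha$ be a power of a prime $p$, let $q=p^\omega$ with $\omega\mid\alpha$, let $H=\mathrm{Gal}(GF(n)/GF(q))$, and let $X$ be the AST obtained from the action of $ASL_H(2,n)$ on the $2$-dimensional vector space $V=GF(n)^2$ over $GF(n)$. Then $X$ has $$-3+2\left(\frac{\omega}{\alpha}\sum_{\beta=1}^{\alpha/\omega}q^{\gcd(\alpha/\omega,\,\beta)}\right)$$ nontrivial relations. There are $$-2+\frac{\omega}{\alpha}\sum_{\beta=1}^{\alpha/\omega}q^{\gcd(\alpha/\omega,\,\beta)}$$ nontrivial relations of the form $R^a=[(\vec 0,\vec 1,\vec a)]$ with $a\in GF(n)$, $a\neq 0,1$; the relation $R^a$ has third valency $\deg_{GF(q)}(a)$. The remaining $$-1+\frac{\omega}{\alpha}\sum_{\beta=1}^{\alpha/\omega}q^{\gcd(\alpha/\omega,\,\beta)}$$ nontrivial relations of $X$ are of the form ${}^{\mathfrak a}R=[(\vec 0,\vec 1,(0,\mathfrak a)^T)]$ with $\mathfrak a\in GF(n)$, $\mathfrak a\neq 0$; the relation ${}^{\mathfrak a}R$ has third valency $n\deg_{GF(q)}(\mathfrak a)$.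
   Context: Association scheme on triples (AST). Let $\Omega$ be a finite set with at least 3 elements. An AST on $\Omega$ is a partition $X=\{R_i\}_{i=0}^m$ of $\Omega\times\Omega\times\Omega$, $m\ge 4$, such that: (1) for each $i$ there is an integer $n_i^{(3)}$ such that for every pair of distinct $x,y\in\Omega$ the number of $z\in\Omega$ with $(x,y,z)\in R_i$ is $n_i^{(3)}$ (called the third valency of $R_i$); (2) for all $i,j,k,l$ there is a constant $p_{ijk}^l$ (an intersection number) such that for every $(x,y,z)\in R_l$ the number of $w$ with $(w,y,z)\in R_i$, $(x,w,z)\in R_j$, $(x,y,w)\in R_k$ is $p_{ijk}^l$; (3) for every $i$ and every $\sigma\in S_3$ there is $j$ with $R_j=\{(x_{\sigma(1)},x_{\sigma(2)},x_{\sigma(3)}):(x_1,x_2,x_3)\in R_i\}$; (4) $R_0=\{(x,x,x):x\in\Omega\}$, $R_1=\{(x,y,y):x\ne y\}$, $R_2=\{(y,x,y):x\neq y\}$, $R_3=\{(y,y,x):x\ne y\}$. The relations $R_0,R_1,R_2,R_3$ are called trivial and all others nontrivial. If a group $G$ acts two-transitively on $\Omega$, the set of orbits of the induced diagonal action of $G$ on $\Omega\times\Omega\times\Omega$ is an AST, called the AST obtained from (the action of) $G$. $GF(n)$ is the field with $n$ elements. For $k\geq 2$, $V=GF(n)^k$ and a subgroup $H$ of the automorphism group $\mathrm{Gal}(GF(n))$ of $GF(n)$ (acting on $V$ coordinatewise), $ASL_H(k,n)=ASL(k,n)\rtimes H$ is the group of maps $V\to V$ of the form $x\mapsto A\phi(x)+b$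 with $A\in SL(k,n)$, $b\in V$, $\phi\in H$. For $a\in GF(n)$, $\vec a=(a,0,\ldots,0)^T\in V$. For $(u,v,w)\in V\times V\times V$, $[(u,v,w)]$ denotes its orbit under $ASL_H(k,n)$ (here $k=2$). $\deg_{GF(q)}(a)$ is the degree of the minimal polynomial of $a$ over $GF(q)$. The relations $R^a$ (respectively ${}^{\mathfrak a}R$) for different parameters may coincide; the counts are of distinct relations. -}

module Defs where

open import Algebra.Bundles using (CommutativeRing)
open import Algebra.Morphism.Structures using (module RingMorphisms)
open import Algebra.Structures using (IsCommutativeRing)
open import Data.Fin using (Fin; toℕ)
open import Data.Fin.Permutation using (Permutation′; _⟨$⟩ʳ_)
open import Data.List using (List; length)
open import Data.List.Membership.Propositional using (_∈_)
open import Data.List.Relation.Unary.Unique.Propositional using (Unique)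
open import Data.Nat using (ℕ; zero; suc; _≤_)
open import Data.Product using (∃; ∃₂; _×_)
open import Data.Vec using (Vec; []; _∷_; foldr′; lookup; map; removeAt; replicate; tabulate; zipWith)
open import Data.Vec.Relation.Unary.All using (All)
open import Function using (_⇔_)
open import Level using (0ℓ)
open import Relation.Binary.PropositionalEquality using (_≡_; _≢_)
open import Relation.Nullary using (¬_)
open import Relation.Unary using (Pred; U; _≐_)

-- The number of elements satisfying P (not of proofs that they do) is n.
HasCard : {A : Set} → Pred A 0ℓ → ℕ → Set
HasCard P n = ∃ λ xs → Unique xs × length xs ≡ n × (∀ x → x ∈ xs ⇔ P x)

------------------------------------------------------------------------
-- Fields

record Field : Set₁ where
  infixl 7 _*_
  infixl 6 _+_
  infix  8 -_
  field
    Carrier           : Set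
    _+_ _*_           : Carrier → Carrier → Carrier
    -_                : Carrier → Carrier
    0# 1#             : Carrier
    isCommutativeRing : IsCommutativeRing _≡_ _+_ _*_ -_ 0# 1#
    0≢1               : 0# ≢ 1#
    inverse           : ∀ x → x ≢ 0# → ∃ λ y → x * y ≡ 1#

  commutativeRing : CommutativeRing 0ℓ 0ℓ
  commutativeRing = record { isCommutativeRing = isCommutativeRing }

  open CommutativeRing commutativeRing public using (rawRing)

record Subfield (F : Field) : Set₁ where
  open Field F
  field
    Member     : Pred Carrier 0ℓ
    0-closed   : Member 0#
    1-closed   : Member 1#
    +-closed   : ∀ {x y} → Member x → Member y → Member (x + y)
    *-closed   : ∀ {x y} → Member x → Member y → Member (x * y)
    neg-closed : ∀ {x} → Member x → Member (- x)
    inv-closed : ∀ {x y} → Member x → x * y ≡ 1# → Member y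

module _ (F : Field) where
  open Field F
  open RingMorphisms rawRing rawRing using (IsRingIsomorphism)

  Gal : Subfield F → Pred (Carrier → Carrier) 0ℓ
  Gal K φ = IsRingIsomorphism φ × (∀ {x} → Subfield.Member K x → φ x ≡ x)

  -- c₀ ∷ c₁ ∷ … ∷ c_{d-1} ∷ [] stands for the monic polynomial
  -- c₀ + c₁ X + … + c_{d-1} X^{d-1} + X^d.
  evalMonic : ∀ {d} → Vec Carrier d → Carrier → Carrier
  evalMonic []       a = 1#
  evalMonic (c ∷ cs) a = c + a * evalMonic cs a

  record MinimalPolynomial (K : Subfield F) (a : Carrier) : Set where
    open Subfield K
    field
      degree  : ℕ
      coeffs  : Vec Carrier degree
      over-K  : All Member coeffs
      root    : evalMonic coeffs a ≡ 0#
      minimal : ∀ {e} (cs : Vec Carrier e) → All Member cs →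
                evalMonic cs a ≡ 0# → degree ≤ e

  V : ℕ → Set
  V k = Vec Carrier k

  -- Vectors of rows.
  Matrix : ℕ → Set
  Matrix k = Vec (V k) k

  infixl 6 _+ᵛ_
  _+ᵛ_ : ∀ {k} → V k → V k → V k
  _+ᵛ_ = zipWith _+_

  dot : ∀ {k} → V k → V k → Carrier
  dot x y = foldr′ _+_ 0# (zipWith _*_ x y)

  infixr 7 _·_
  _·_ : ∀ {k} → Matrix k → V k → V k
  A · x = map (λ row → dot row x) A

  -- Laplace expansion along the first row; the right-nested subtraction
  -- x₀ - (x₁ - (x₂ - …)) produces the alternating signs.
  det : ∀ {k} → Matrix k → Carrier
  det {zero}  []         = 1#
  det {suc k} (row ∷ rows) =
    foldr′ (λ x y → x + - y) 0#
      (tabulate λ j → lookup row j * det (map (λ r → removeAt r j) rows))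

  ASL : Pred (Carrier → Carrier) 0ℓ → ∀ k → Pred (V k → V k) 0ℓ
  ASL H k g = ∃ λ (A : Matrix k) → ∃₂ λ (φ : Carrier → Carrier) (b : V k) →
    det A ≡ 1# × H φ × (∀ x → g x ≡ A · map φ x +ᵛ b)

  embed₁ : ∀ {k} → Carrier → V (suc k)
  embed₁ a = a ∷ replicate _ 0#

------------------------------------------------------------------------
-- Association schemes on triples

Triple : Set → Set
Triple Ω = Vec Ω 3

pattern ⟨_,_,_⟩ x y z = x ∷ y ∷ z ∷ []

Rel₃ : Set → Set₁
Rel₃ Ω = Pred (Triple Ω) 0ℓ

permute : {Ω : Set} → Permutation′ 3 → Triple Ω → Triple Ω
permute σ t = tabulate λ i → lookup t (σ ⟨$⟩ʳ i)

HasThirdValency : {Ω : Set} → Rel₃ Ω → ℕ → Set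
HasThirdValency R n = ∀ {x y} → x ≢ y → HasCard (λ z → R ⟨ x , y , z ⟩) n

record AST (Ω : Set) : Set₁ where
  field
    finite : ∃ λ N → HasCard {Ω} U N × 3 ≤ N
    m      : ℕ
    m≥4    : 4 ≤ m
    R      : Fin (suc m) → Rel₃ Ω

    nonempty : ∀ i → ∃ λ t → R i t
    cover    : ∀ t → ∃ λ i → R i t
    disjoint : ∀ {i j t} → R i t → R j t → i ≡ j

    thirdValency : ∀ i → ∃ λ n → HasThirdValency (R i) n

    intersectionNumber : ∀ i j k l → ∃ λ p → ∀ {x y z} → R l ⟨ x , y , z ⟩ →
      HasCard (λ w → R i ⟨ w , y , z ⟩ × R j ⟨ x , w , z ⟩ × R k ⟨ x , y , w ⟩) p

    permuted : ∀ i (σ : Permutation′ 3) → ∃ λ j →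
      R j ≐ (λ s → ∃ λ t → R i t × s ≡ permute σ t)

    trivial₀ : ∀ i → toℕ i ≡ 0 → R i ≐ (λ t → ∃ λ x → t ≡ ⟨ x , x , x ⟩)
    trivial₁ : ∀ i → toℕ i ≡ 1 → R i ≐ (λ t → ∃₂ λ x y → x ≢ y × t ≡ ⟨ x , y , y ⟩)
    trivial₂ : ∀ i → toℕ i ≡ 2 → R i ≐ (λ t → ∃₂ λ x y → x ≢ y × t ≡ ⟨ y , x , y ⟩)
    trivial₃ : ∀ i → toℕ i ≡ 3 → R i ≐ (λ t → ∃₂ λ x y → x ≢ y × t ≡ ⟨ y , y , x ⟩)

  Nontrivial : Pred (Fin (suc m)) 0ℓ
  Nontrivial i = 4 ≤ toℕ i

-- A group of permutations of Ω is given by the set G of its elements.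
Orbit : {Ω : Set} → Pred (Ω → Ω) 0ℓ → Triple Ω → Rel₃ Ω
Orbit G t s = ∃ λ g → G g × s ≡ map g t

_ObtainedFrom_ : {Ω : Set} → AST Ω → Pred (Ω → Ω) 0ℓ → Set
X ObtainedFrom G =
  (∀ i → ∃ λ t → R i ≐ Orbit G t) × (∀ t → ∃ λ i → R i ≐ Orbit G t)
  where open AST X

------------------------------------------------------------------------
-- The two families of relations on V = GF(n)²

module _ (F : Field) (H : Pred (Field.Carrier F → Field.Carrier F) 0ℓ) where
  open Field F

  -- R^a = [(0⃗, 1⃗, a⃗)]
  upperR : Carrier → Rel₃ (V F 2)
  upperR a = Orbit (ASL F H 2) ⟨ embed₁ F 0# , embed₁ F 1# , embed₁ F a ⟩

  -- ᵃR = [(0⃗, 1⃗, (0,a)ᵀ)]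
  leftR : Carrier → Rel₃ (V F 2)
  leftR a = Orbit (ASL F H 2) ⟨ embed₁ F 0# , embed₁ F 1# , 0# ∷ a ∷ [] ⟩

  -- Since the relations of an AST are pairwise disjoint and nonempty, counting
  -- indices counts distinct relations, even though different a may give the
  -- same relation.
  module _ (X : AST (V F 2)) where
    open AST X

    IsUpper : Pred (Fin (suc m)) 0ℓ
    IsUpper i = Nontrivial i × ∃ λ a → a ≢ 0# × a ≢ 1# × R i ≐ upperR a

    IsLeft : Pred (Fin (suc m)) 0ℓ
    IsLeft i = Nontrivial i × ∃ λ a → a ≢ 0# × R i ≐ leftR a

    Remaining : Pred (Fin (suc m)) 0ℓ
    Remaining i = Nontrivial i × ¬ IsUpper i

{-# OPTIONS --safe #-}
module Submission where

-- In coordinates adapted to (x , y), the orbit of (0⃗ , 1⃗ , a⃗) contains (x , y , z)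
-- iff z = x + φ(a)(y - x) for some φ ∈ H, and the orbit of (0⃗ , 1⃗ , (0,a)ᵀ) contains it
-- iff det(y - x , z - x) = φ(a) for some φ ∈ H. Hence both families of relations
-- are indexed by the H-orbits on GF(n), without {0}, {1} and without {0} respectively,
-- and the valencies are |Ha| and n |Ha|.
--
-- The H-orbits are those of σ(x) = x^q alone: the product of X - σⁱ(a) over the
-- orbit of a under σ has coefficients in GF(q), so every φ ∈ H maps a into that
-- orbit, and this product is the minimal polynomial of a. By Burnside's lemma the
-- number of orbits is the average of the number of fixed points of σ^β, which is
-- q^gcd(α/ω, β).

-- `H` is a predicate on functions, and functions that agree pointwise need not be propositionally
-- equal, so Burnside's lemma is applied not to `H` but to exponents modulo d = α/ω, which act
-- through the iterates of σ. That σᵈ = id is Fermat's theorem, because n = q^d.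
--
-- The number of fixed points has two sources. By Bézout and σᵈ = id, the maps σ^β and σ^g with g =
-- gcd(d, β) fix the same elements. Since g divides d, q^g - 1 divides n - 1, so X^(q^g - 1) - 1
-- divides X^(n - 1) - 1, which has n - 1 roots in the field. Bounding the roots of the cofactor
-- leaves the divisor its full number of roots, and 0 is one more fixed point.
--
-- The number c of orbits is exhibited as k + 2, so that the families have exactly k and k + 1
-- members and all counting takes place in ℕ. Only the last step passes to the rational numbers of
-- the statement.

open import Defs

-- Cardinalities of predicates, given by duplicate-free enumerations

module Counting where

  open import Defs using (HasCard)
  open import Data.List using (List; []; _∷_; _++_; length; map; filter; cartesianProductWith)
  open import Data.List.Membership.Propositional using (_∈_)
  open import Data.List.Membership.Propositional.Properties
  open import Data.List.Membership.Propositional.Properties.WithK using (unique∧set⇒bag)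
  open import Data.List.Properties using (length-map; length-++)
  open import Data.List.Relation.Binary.BagAndSetEquality using (∼bag⇒↭)
  open import Data.List.Relation.Binary.Permutation.Propositional using (_↭_)
  open import Data.List.Relation.Binary.Permutation.Propositional.Properties using (↭-length)
  open import Data.List.Relation.Unary.All as All using (All; []; _∷_)
  open import Data.List.Relation.Unary.All.Properties as All using ()
  open import Data.List.Relation.Unary.AllPairs using ([]; _∷_)
  open import Data.List.Relation.Unary.Any as Any using (here; there)
  open import Data.List.Relation.Unary.Any.Properties using (lookup-index)
  open import Data.List.Relation.Unary.Unique.Propositional using (Unique)
  open import Data.List.Relation.Unary.Unique.Propositional.Properties using (++⁺; filter⁺; cartesianProductWith⁺)
  open import Data.Fin using (_≟_)
  open import Data.List using (lookup)
  open import Data.Nat using (ℕ; suc; _+_; _*_)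
  open import Data.Product using (∃; _×_; _,_; proj₁)
  open import Data.Sum as Sum using (inj₁; inj₂)
  open import Data.Unit using (tt)
  open import Function using (_∘_; _⇔_; mk⇔; Equivalence)
  open import Function.Construct.Composition using (_⇔-∘_)
  open import Function.Construct.Symmetry using (⇔-sym)
  open import Level using (0ℓ)
  open import Relation.Binary.Definitions using (DecidableEquality)
  open import Relation.Binary.PropositionalEquality
  open import Relation.Nullary using (¬_; yes; no; ¬?)
  open import Relation.Nullary.Decidable using (map′)
  open import Relation.Unary using (Pred; Decidable; U; _≐_; _∩_; _∪_)

  private
    variable
      A B C : Set
      P Q : Pred A 0ℓ
      m n : ℕ

  -- Multiplicities in a duplicate-free list are 0 or 1, so equality as sets is already equality as
  -- bags.
  unique-↭ : {xs ys : List A} → Unique xs → Unique ys → (∀ x → x ∈ xs ⇔ x ∈ ys) → xs ↭ ys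
  unique-↭ u v xs⇔ys = ∼bag⇒↭ (unique∧set⇒bag u v λ {x} → xs⇔ys x)

  card-unique : HasCard P m → HasCard P n → m ≡ n
  card-unique (_ , u , refl , xs⇔) (_ , v , refl , ys⇔) =
    ↭-length (unique-↭ u v λ x → ⇔-sym (ys⇔ x) ⇔-∘ xs⇔ x)

  card-≐ : P ≐ Q → HasCard P n → HasCard Q n
  card-≐ (f , g) (xs , u , l , xs⇔) = xs , u , l , λ x → mk⇔ f g ⇔-∘ xs⇔ x

  unique-map : (f : A → B) {xs : List A} → (∀ {x y} → x ∈ xs → y ∈ xs → f x ≡ f y → x ≡ y) →
               Unique xs → Unique (map f xs)
  unique-map f inj []       = []
  unique-map f inj (p ∷ u) =
    All.map⁺ (All.tabulate λ y∈ fx≡fy → All.lookup p y∈ (inj (here refl) (there y∈) fx≡fy)) ∷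
    unique-map f (λ x∈ y∈ → inj (there x∈) (there y∈)) u

  card-image : (f : A → B) → (∀ {x y} → P x → P y → f x ≡ f y → x ≡ y) →
               HasCard P n → HasCard (λ b → ∃ λ a → P a × b ≡ f a) n
  card-image f inj (xs , u , l , xs⇔) =
    map f xs , unique-map f (λ x∈ y∈ → inj (to (xs⇔ _) x∈) (to (xs⇔ _) y∈)) u ,
    trans (length-map f xs) l , λ b → mk⇔
      (λ b∈ → let a , a∈ , eq = ∈-map⁻ f b∈ in a , to (xs⇔ a) a∈ , eq)
      (λ where (a , pa , refl) → ∈-map⁺ f (from (xs⇔ a) pa))
    where open Equivalence

  card-∪ : (∀ {x} → P x → ¬ Q x) →
           HasCard P m → HasCard Q n → HasCard (P ∪ Q) (m + n)
  card-∪ disj (xs , u , l , xs⇔) (ys , v , k , ys⇔) =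
    xs ++ ys ,
    ++⁺ u v (λ (x∈ , y∈) → disj (to (xs⇔ _) x∈) (to (ys⇔ _) y∈)) ,
    trans (length-++ xs) (cong₂ _+_ l k) ,
    λ x → mk⇔ (Sum.map (to (xs⇔ x)) (to (ys⇔ x)) ∘ ∈-++⁻ xs)
              Sum.[ ∈-++⁺ˡ ∘ from (xs⇔ x) , ∈-++⁺ʳ xs ∘ from (ys⇔ x) ]
    where open Equivalence

  length-cartesianProductWith : (f : A → B → C) (xs : List A) (ys : List B) →
                                length (cartesianProductWith f xs ys) ≡ length xs * length ys
  length-cartesianProductWith f []       ys = refl
  length-cartesianProductWith f (x ∷ xs) ys =
    trans (length-++ (map (f x) ys))
          (cong₂ _+_ (length-map (f x) ys) (length-cartesianProductWith f xs ys))

  card-cartesian : (f : A → B → C) → (∀ {w x y z} → f w y ≡ f x z → w ≡ x × y ≡ z) →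
                   HasCard P m → HasCard Q n →
                   HasCard (λ c → ∃ λ a → ∃ λ b → P a × Q b × c ≡ f a b) (m * n)
  card-cartesian f inj (xs , u , refl , xs⇔) (ys , v , refl , ys⇔) =
    cartesianProductWith f xs ys , cartesianProductWith⁺ f inj u v ,
    length-cartesianProductWith f xs ys , λ c → mk⇔
      (λ c∈ → let a , b , a∈ , b∈ , eq = ∈-cartesianProductWith⁻ f xs ys c∈
              in a , b , to (xs⇔ a) a∈ , to (ys⇔ b) b∈ , eq)
      (λ where (a , b , pa , qb , refl) → ∈-cartesianProductWith⁺ f (from (xs⇔ a) pa) (from (ys⇔ b) qb))
    where open Equivalence

  card-filter : Decidable Q → HasCard P n → ∃ (HasCard (P ∩ Q))
  card-filter Q? (xs , u , _ , xs⇔) =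
    _ , filter Q? xs , filter⁺ Q? u , refl , λ x → mk⇔
      (λ x∈ → let x∈xs , qx = ∈-filter⁻ Q? x∈ in to (xs⇔ x) x∈xs , qx)
      (λ (px , qx) → ∈-filter⁺ Q? (from (xs⇔ x) px) qx)
    where open Equivalence

  card-singleton : (x : A) → HasCard (_≡ x) 1
  card-singleton x = x ∷ [] , [] ∷ [] , refl , λ y → mk⇔ (λ where (here eq) → eq; (there ())) here

  -- Returning the equation with `suc k` lets a match on it expose the shape of a cardinality.
  -- Deleting 0 and then 1 in this way shows q ≥ 2, and later subtracts the two trivial orbits
  -- without truncated subtraction.
  card-delete : DecidableEquality A → {P : Pred A 0ℓ} {x : A} → P x → HasCard P n →
                ∃ λ k → n ≡ suc k × HasCard (P ∩ (_≢ x)) k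
  card-delete _≟ᴬ_ {P} {x} px P-card with card-filter (λ y → ¬? (y ≟ᴬ x)) P-card
  ... | k , rest = k , card-unique P-card (card-≐ (glue , cut) (card-∪ (λ eq (_ , ne) → ne eq) (card-singleton x) rest)) , rest
    where
    glue : ∀ {y} → ((_≡ x) ∪ (P ∩ (_≢ x))) y → P y
    glue (inj₁ refl)     = px
    glue (inj₂ (py , _)) = py
    cut : ∀ {y} → P y → ((_≡ x) ∪ (P ∩ (_≢ x))) y
    cut {y} py with y ≟ᴬ x
    ... | yes eq = inj₁ eq
    ... | no  ne = inj₂ (py , ne)

  -- An element is determined by its position in the enumeration, and positions in `Fin` can be
  -- compared. All case distinctions on field elements rest on this.
  finite⇒≟ : HasCard {A} U n → DecidableEquality A
  finite⇒≟ (xs , _ , _ , xs⇔) x y =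
    map′ (λ eq → trans (lookup-index (mem x)) (trans (cong (lookup xs) eq) (sym (lookup-index (mem y)))))
         (cong (Any.index ∘ mem)) (Any.index (mem x) ≟ Any.index (mem y))
    where
    mem : ∀ z → z ∈ xs
    mem z = Equivalence.from (xs⇔ z) tt

  -- Membership in a subfield is an abstract predicate; its enumeration makes it decidable, which a
  -- proof of membership by contradiction requires.
  card⇒decidable : DecidableEquality A → {P : Pred A 0ℓ} → HasCard P n → Decidable P
  card⇒decidable _≟ᴬ_ (xs , _ , _ , xs⇔) x = map′ (to (xs⇔ x)) (from (xs⇔ x)) (Any.any? (x ≟ᴬ_) xs)
    where open Equivalence

  all∈ : (c : HasCard {A} U n) → ∀ x → x ∈ proj₁ c
  all∈ (_ , _ , _ , xs⇔) x = Equivalence.from (xs⇔ x) tt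

-- Finite sums, iterates of a map, and Burnside's lemma for a cyclic action

module Orbits where

  open Counting
  open import Defs using (HasCard)
  open import Data.Bool using (if_then_else_)
  open import Data.List using (List; []; _∷_; length; map; filter; applyUpTo; upTo)
  open import Data.List.Membership.Propositional using (_∈_)
  open import Data.List.Membership.Propositional.Properties using (∈-filter⁺; ∈-filter⁻; ∈-applyUpTo⁺; ∈-applyUpTo⁻)
  open import Data.List.Properties using (map-upTo; map-applyUpTo; length-upTo; length-applyUpTo; map-cong; map-cong-local; filter-≐)
  open import Data.List.Relation.Unary.All as All using ([]; _∷_)
  open import Data.List.Relation.Unary.AllPairs using ([]; _∷_)
  open import Data.List.Relation.Unary.Any using (here; there)
  open import Data.List.Relation.Unary.Unique.Propositional using (Unique)
  open import Data.List.Relation.Unary.Unique.Propositional.Properties using (applyUpTo⁺₁)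
  open import Data.Nat using (ℕ; zero; suc; pred; _+_; _*_; _≤_; _<_; s≤s; s≤s⁻¹; NonZero)
  open import Data.Nat.DivMod using (_/_; _%_; m≡m%n+[m/n]*n; m%n<n)
  open import Data.Nat.GeneralisedArithmetic using (fold; fold-+)
  open import Data.Nat.ListAction using (sum)
  open import Data.Nat.Properties hiding (_≟_)
  open import Data.Nat.Solver using (module +-*-Solver)
  open import Data.Product using (∃; _×_; _,_; proj₁; proj₂)
  open import Data.Unit using (tt)
  open import Function using (_∘_; mk⇔; Equivalence)
  open import Level using (0ℓ)
  open import Relation.Binary.PropositionalEquality
  open import Relation.Nullary using (¬_; Dec; yes; no; does; contradiction)
  open import Relation.Nullary.Decidable using (map′)
  open import Relation.Unary using (Pred; Decidable; U)

  private
    variable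
      A B : Set

  open ≡-Reasoning

  Σ : List A → (A → ℕ) → ℕ
  Σ xs f = sum (map f xs)

  Σ-cong : (xs : List A) {f g : A → ℕ} → (∀ {x} → x ∈ xs → f x ≡ g x) → Σ xs f ≡ Σ xs g
  Σ-cong xs eq = cong sum (map-cong-local (All.tabulate eq))

  Σ-const : (xs : List A) (k : ℕ) → Σ xs (λ _ → k) ≡ length xs * k
  Σ-const []       k = refl
  Σ-const (x ∷ xs) k = cong (k +_) (Σ-const xs k)

  Σ-+ : (xs : List A) (f g : A → ℕ) → Σ xs (λ x → f x + g x) ≡ Σ xs f + Σ xs g
  Σ-+ []       f g = refl
  Σ-+ (x ∷ xs) f g = begin
    f x + g x + Σ xs (λ x → f x + g x) ≡⟨ cong (f x + g x +_) (Σ-+ xs f g) ⟩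
    f x + g x + (Σ xs f + Σ xs g)      ≡⟨ solve 4 (λ a b c d → a :+ b :+ (c :+ d) := a :+ c :+ (b :+ d)) refl (f x) (g x) _ _ ⟩
    f x + Σ xs f + (g x + Σ xs g)      ∎
    where open +-*-Solver

  Σ-swap : (xs : List A) (ys : List B) (f : A → B → ℕ) →
           Σ xs (λ x → Σ ys (f x)) ≡ Σ ys (λ y → Σ xs (λ x → f x y))
  Σ-swap []       ys f = sym (trans (Σ-const ys 0) (*-zeroʳ (length ys)))
  Σ-swap (x ∷ xs) ys f = trans (cong (Σ ys (f x) +_) (Σ-swap xs ys f)) (sym (Σ-+ ys (f x) _))

  Σ-single : {xs : List A} {x : A} (f : A → ℕ) → Unique xs → x ∈ xs →
             (∀ {y} → y ∈ xs → y ≢ x → f y ≡ 0) → Σ xs f ≡ f x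
  Σ-single {xs = _ ∷ xs} f (p ∷ u) (here refl) vanish = begin
    f _ + Σ xs f          ≡⟨ cong (f _ +_) (Σ-cong xs λ y∈ → vanish (there y∈) (All.lookup p y∈ ∘ sym)) ⟩
    f _ + Σ xs (λ _ → 0)  ≡⟨ cong (f _ +_) (trans (Σ-const xs 0) (*-zeroʳ (length xs))) ⟩
    f _ + 0               ≡⟨ +-identityʳ _ ⟩
    f _                   ∎
  Σ-single {xs = _ ∷ xs} f (p ∷ u) (there x∈) vanish =
    cong₂ _+_ (vanish (here refl) (All.lookup p x∈)) (Σ-single f u x∈ (vanish ∘ there))

  indicator : {P : Set} → Dec P → ℕ
  indicator P? = if does P? then 1 else 0

  indicator-yes : {P : Set} (P? : Dec P) → P → indicator P? ≡ 1
  indicator-yes (yes _) _ = refl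
  indicator-yes (no ¬p) p = contradiction p ¬p

  indicator-no : {P : Set} (P? : Dec P) → ¬ P → indicator P? ≡ 0
  indicator-no (no _)  _  = refl
  indicator-no (yes p) ¬p = contradiction p ¬p

  length-filter-Σ : {P : Pred A 0ℓ} (P? : Decidable P) (xs : List A) →
                    length (filter P? xs) ≡ Σ xs (indicator ∘ P?)
  length-filter-Σ P? []       = refl
  length-filter-Σ P? (x ∷ xs) with P? x
  ... | yes _ = cong suc (length-filter-Σ P? xs)
  ... | no  _ = length-filter-Σ P? xs

  sum-applyUpTo-last : (h : ℕ → ℕ) (d : ℕ) → sum (applyUpTo h (suc d)) ≡ sum (applyUpTo h d) + h d
  sum-applyUpTo-last h zero    = +-identityʳ (h 0)
  sum-applyUpTo-last h (suc d) = trans (cong (h 0 +_) (sum-applyUpTo-last (h ∘ suc) d)) (sym (+-assoc (h 0) _ _))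

  module _ (d : ℕ) where

    -- With `h 0` added, the left side is the sum over 0, ..., d, whose last term `h d` equals `h 0`
    -- by periodicity.
    sum-periodic-suc : (h : ℕ → ℕ) → (∀ i → h (i + d) ≡ h i) →
                       sum (applyUpTo (h ∘ suc) d) ≡ sum (applyUpTo h d)
    sum-periodic-suc h periodic = +-cancelˡ-≡ (h 0) _ _ (begin
      h 0 + sum (applyUpTo (h ∘ suc) d) ≡⟨ sum-applyUpTo-last h d ⟩
      sum (applyUpTo h d) + h d         ≡⟨ +-comm _ (h d) ⟩
      h d + sum (applyUpTo h d)         ≡⟨ cong (_+ sum (applyUpTo h d)) (periodic 0) ⟩
      h 0 + sum (applyUpTo h d)         ∎)

    sum-periodic : (h : ℕ → ℕ) → (∀ i → h (i + d) ≡ h i) → ∀ k →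
                   Σ (upTo d) (λ i → h (i + k)) ≡ Σ (upTo d) h
    sum-periodic h periodic zero    = Σ-cong (upTo d) (λ {i} _ → cong h (+-identityʳ i))
    sum-periodic h periodic (suc k) = begin
      Σ (upTo d) (λ i → h (i + suc k))          ≡⟨ cong sum (map-cong (λ i → cong h (+-suc i k)) (upTo d)) ⟩
      Σ (upTo d) (λ i → h (suc i + k))          ≡⟨ cong sum (map-upTo _ d) ⟩
      sum (applyUpTo (λ i → h (suc i + k)) d)   ≡⟨ sum-periodic-suc (λ i → h (i + k)) shifted ⟩
      sum (applyUpTo (λ i → h (i + k)) d)       ≡⟨ cong sum (map-upTo _ d) ⟨
      Σ (upTo d) (λ i → h (i + k))              ≡⟨ sum-periodic h periodic k ⟩
      Σ (upTo d) h                              ∎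
      where
      shifted : ∀ i → h (i + d + k) ≡ h (i + k)
      shifted i = trans (cong h (solve 3 (λ i d k → i :+ d :+ k := i :+ k :+ d) refl i d k)) (periodic (i + k))
        where open +-*-Solver

  firstOr : A → List A → A
  firstOr x []      = x
  firstOr x (y ∷ _) = y

  firstOr-∈ : {x : A} {xs : List A} → x ∈ xs → firstOr x xs ∈ xs
  firstOr-∈ (here _)  = here refl
  firstOr-∈ (there _) = here refl

  firstOr-irrelevant : {x y : A} {xs : List A} → x ∈ xs → firstOr x xs ≡ firstOr y xs
  firstOr-irrelevant (here _)  = refl
  firstOr-irrelevant (there _) = refl

  module Iteration {A : Set} (σ : A → A) where

    iter : ℕ → A → A
    iter k x = fold x σ k

    iter-+ : ∀ m n x → iter (m + n) x ≡ iter m (iter n x)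
    iter-+ m n x = fold-+ x σ m

    iter-fixed : ∀ m n {x} → iter n x ≡ x → iter (m * n) x ≡ x
    iter-fixed zero    n fixed = refl
    iter-fixed (suc m) n fixed =
      trans (iter-+ n (m * n) _) (trans (cong (iter n) (iter-fixed m n fixed)) fixed)

    iter-% : ∀ n k .{{_ : NonZero n}} {x} → iter n x ≡ x → iter (k % n) x ≡ iter k x
    iter-% n k {x} fixed = begin
      iter (k % n) x                      ≡⟨ cong (iter (k % n)) (iter-fixed (k / n) n fixed) ⟨
      iter (k % n) (iter (k / n * n) x)   ≡⟨ iter-+ (k % n) (k / n * n) x ⟨
      iter (k % n + k / n * n) x          ≡⟨ cong (λ k → iter k x) (m≡m%n+[m/n]*n k n) ⟨
      iter k x                            ∎

    iter-suc : ∀ k x → iter (suc k) x ≡ iter k (σ x)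
    iter-suc k x = trans (cong (λ j → iter j x) (+-comm 1 k)) (iter-+ k 1 x)

    iter-injective : (∀ {x y} → σ x ≡ σ y → x ≡ y) → ∀ k {x y} → iter k x ≡ iter k y → x ≡ y
    iter-injective σ-injective zero    eq = eq
    iter-injective σ-injective (suc k) eq = iter-injective σ-injective k (σ-injective eq)

    -- After the i steps that return x to itself, g more make j steps in all, so these g must return
    -- x as well. The shape g + i = j is that of Bézout's identity in ℕ.
    iter-difference-fixed : ∀ g i {j x} → iter i x ≡ x → iter j x ≡ x → g + i ≡ j → iter g x ≡ x
    iter-difference-fixed g i fixᵢ fixⱼ refl =
      trans (cong (iter g) (sym fixᵢ)) (trans (sym (iter-+ g i _)) fixⱼ)

    infix 4 _∼_
    _∼_ : A → A → Set
    x ∼ y = ∃ λ k → iter k x ≡ y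

    -- Exponents reduce modulo the period e + 1. If two of the listed iterates agreed, cancelling
    -- the smaller exponent by injectivity would give a return to x before the period.
    orbit-card : (∀ {x y} → σ x ≡ σ y → x ≡ y) → ∀ {e x} → iter (suc e) x ≡ x →
                 (∀ {k} → k < e → iter (suc k) x ≢ x) → HasCard (x ∼_) (suc e)
    orbit-card σ-injective {e} {x} period minimal =
      applyUpTo (λ k → iter k x) (suc e) , applyUpTo⁺₁ _ (suc e) distinct , length-applyUpTo (λ k → iter k x) (suc e) , λ y → mk⇔
        (λ y∈ → let k , _ , eq = ∈-applyUpTo⁻ (λ k → iter k x) y∈ in k , sym eq)
        (λ where (k , refl) → subst (_∈ _) (iter-% (suc e) k period) (∈-applyUpTo⁺ (λ k → iter k x) (m%n<n k (suc e))))
      where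
      distinct : ∀ {i j} → i < j → j < suc e → iter i x ≢ iter j x
      distinct {i} i<j j≤e eq with k , refl ← m≤n⇒∃[o]m+o≡n i<j = minimal (≤-trans (s≤s (m≤n+m k i)) (s≤s⁻¹ j≤e))
        (sym (iter-injective σ-injective i (trans eq (trans (cong (λ j → iter j x) (sym (+-suc i k))) (iter-+ i (suc k) x)))))

  least : {P : Pred ℕ 0ℓ} → Decidable P → ∀ {n} → P n → ∃ λ m → P m × (∀ {k} → k < m → ¬ P k)
  least {P} P? {n} pn = search n (≤-reflexive refl) pn
    where
    -- The bound `b` makes the recursion structural: a witness below some m ≤ b + 1 is at most b.
    search : ∀ {m} b → m ≤ b → P m → ∃ λ m → P m × (∀ {k} → k < m → ¬ P k)
    search {m} b m≤b pm with anyUpTo? P? m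
    ... | no  none            = m , pm , λ {k} k<m pk → none (k , k<m , pk)
    search {m} (suc b) m≤b pm | yes (k , k<m , pk) = search b (s≤s⁻¹ (≤-trans k<m m≤b)) pk
    search {m} zero m≤b pm    | yes (k , k<m , pk) = contradiction (≤-trans k<m m≤b) n≮0

  module CyclicOrbits {A : Set} {N : ℕ} (A-card : HasCard {A} U N)
                      (σ : A → A) (d : ℕ) .{{_ : NonZero d}} where

    open Iteration σ public

    module _ (σᵈ≡id : ∀ x → iter d x ≡ x) where

      private
        xs : List A
        xs = proj₁ A-card

        _≟_ = finite⇒≟ A-card

      ∼-sym : ∀ {x y} → x ∼ y → y ∼ x
      -- The way back from σᵏ x takes k(d - 1) steps, which complete kd steps, that is, k times σᵈ =
      -- id.
      ∼-sym {x} (k , refl) = k * pred d , (begin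
        iter (k * pred d) (iter k x)  ≡⟨ iter-+ (k * pred d) k x ⟨
        iter (k * pred d + k) x       ≡⟨ cong (λ m → iter m x) (trans (+-comm _ k) (trans (sym (*-suc k (pred d))) (cong (k *_) (suc-pred d)))) ⟩
        iter (k * d) x                ≡⟨ iter-fixed k d (σᵈ≡id x) ⟩
        x                             ∎)

      ∼-trans : ∀ {x y z} → x ∼ y → y ∼ z → x ∼ z
      ∼-trans (k , refl) (l , refl) = l + k , iter-+ l k _

      _∼?_ : ∀ x y → Dec (x ∼ y)
      x ∼? y = map′ (λ (k , _ , eq) → k , eq)
                    (λ (k , eq) → k % d , m%n<n k d , trans (iter-% d k (σᵈ≡id x)) eq)
                    (anyUpTo? (λ k → iter k x ≟ y) d)

      -- The member of the orbit that the enumeration lists first. The filtered list contains x, so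
      -- the default never decides the value, and the value depends on the orbit alone.
      representative : A → A
      representative x = firstOr x (filter (x ∼?_) xs)

      private
        self∈ : ∀ x → x ∈ filter (x ∼?_) xs
        self∈ x = ∈-filter⁺ (x ∼?_) (all∈ A-card x) (0 , refl)

      ∼-representative : ∀ x → x ∼ representative x
      ∼-representative x = proj₂ (∈-filter⁻ (x ∼?_) {xs = xs} (firstOr-∈ (self∈ x)))

      representative-cong : ∀ {x y} → x ∼ y → representative x ≡ representative y
      representative-cong {x} {y} x∼y = trans (firstOr-irrelevant (self∈ x)) (cong (firstOr y)
        (filter-≐ (x ∼?_) (y ∼?_) (∼-trans (∼-sym x∼y) , ∼-trans x∼y) xs))

      IsRepresentative : Pred A 0ℓ
      IsRepresentative x = representative x ≡ x

      representative-unique : ∀ {x y} → IsRepresentative x → IsRepresentative y → x ∼ y → x ≡ y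
      representative-unique rx ry x∼y = trans (sym rx) (trans (representative-cong x∼y) ry)

      -- Burnside's lemma: both sides count the pairs (k , x) with σᵏ x = x. Within
      -- the orbit of r, the stabilizer of y has as many elements as the set of k
      -- with σᵏ r = y, and every k sends r to exactly one y.
      burnside : (fix : ℕ → ℕ) → (∀ k → HasCard (λ x → iter (suc k) x ≡ x) (fix (suc k))) →
                 ∃ λ c → HasCard IsRepresentative c × sum (map fix (applyUpTo suc d)) ≡ c * d
      burnside fix fix-card = c , reps-card , (begin
        sum (map fix (applyUpTo suc d))                     ≡⟨ cong sum (trans (map-applyUpTo suc fix d) (sym (map-upTo (fix ∘ suc) d))) ⟩
        Σ (upTo d) (λ k → fix (suc k))                      ≡⟨ Σ-cong (upTo d) (λ {k} _ → fix≡Σ k) ⟩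
        Σ (upTo d) (λ k → Σ xs (λ x → hit (suc k) x x))     ≡⟨ Σ-swap (upTo d) xs _ ⟩
        Σ xs (λ x → Σ (upTo d) (λ k → hit (suc k) x x))     ≡⟨ Σ-cong xs (λ {x} _ → trans (stabilizer x) (sym (only-representative x))) ⟩
        Σ xs (λ x → Σ reps (λ r → Σ (upTo d) (λ k → hit k r x))) ≡⟨ Σ-swap xs reps _ ⟩
        Σ reps (λ r → Σ xs (λ x → Σ (upTo d) (λ k → hit k r x))) ≡⟨ Σ-cong reps (λ {r} _ → hits r) ⟩
        Σ reps (λ _ → d)                                    ≡⟨ Σ-const reps d ⟩
        length reps * d                                     ≡⟨ cong (_* d) (proj₁ (proj₂ (proj₂ reps-card))) ⟩
        c * d                                               ∎)
        where
        filtered = card-filter (λ x → representative x ≟ x) A-card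

        c : ℕ
        c = proj₁ filtered

        reps-card : HasCard IsRepresentative c
        reps-card = card-≐ (proj₂ , (tt ,_)) (proj₂ filtered)

        reps : List A
        reps = proj₁ reps-card

        hit : ℕ → A → A → ℕ
        hit k x y = indicator (iter k x ≟ y)

        fix≡Σ : ∀ k → fix (suc k) ≡ Σ xs (λ x → hit (suc k) x x)
        fix≡Σ k = trans
          (card-unique (fix-card k) (card-≐ (proj₂ , (tt ,_)) (proj₂ (card-filter (λ x → iter (suc k) x ≟ x) A-card))))
          (length-filter-Σ (λ x → iter (suc k) x ≟ x) xs)

        -- With x = σᵐ r, a return of x after k + 1 steps is an arrival at x from r after k + (m +
        -- 1) steps, and shifting a sum over a full period changes nothing. The same shift
        -- reconciles the range 1, ..., d of β with the range 0, ..., d - 1 of the exponents.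
        stabilizer : ∀ x → Σ (upTo d) (λ k → hit (suc k) x x) ≡ Σ (upTo d) (λ k → hit k (representative x) x)
        stabilizer x with representative x | ∼-sym (∼-representative x)
        ... | r | m , refl = begin
          Σ (upTo d) (λ k → hit (suc k) (iter m r) (iter m r)) ≡⟨ Σ-cong (upTo d) (λ {k} _ → cong (λ y → indicator (y ≟ iter m r))
                                                                     (trans (sym (iter-+ (suc k) m r)) (cong (λ j → iter j r) (sym (+-suc k m))))) ⟩
          Σ (upTo d) (λ k → hit (k + suc m) r (iter m r))      ≡⟨ sum-periodic d (λ k → hit k r (iter m r))
                                                                     (λ k → cong (λ y → indicator (y ≟ iter m r))
                                                                       (trans (iter-+ k d r) (cong (iter k) (σᵈ≡id r)))) (suc m) ⟩
          Σ (upTo d) (λ k → hit k r (iter m r))                ∎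

        only-representative : ∀ x → Σ reps (λ r → Σ (upTo d) (λ k → hit k r x)) ≡ Σ (upTo d) (λ k → hit k (representative x) x)
        only-representative x = Σ-single _ (proj₁ (proj₂ reps-card))
          (Equivalence.from (proj₂ (proj₂ (proj₂ reps-card)) _) (sym (representative-cong (∼-representative x))))
          λ {r} r∈ r≢ → trans
            (Σ-cong (upTo d) λ {k} _ → indicator-no (iter k r ≟ x) λ eq → r≢
              (trans (sym (Equivalence.to (proj₂ (proj₂ (proj₂ reps-card)) _) r∈)) (representative-cong (k , eq))))
            (trans (Σ-const (upTo d) 0) (*-zeroʳ (length (upTo d))))

        hits : ∀ r → Σ xs (λ x → Σ (upTo d) (λ k → hit k r x)) ≡ d
        hits r = begin
          Σ xs (λ x → Σ (upTo d) (λ k → hit k r x)) ≡⟨ Σ-swap xs (upTo d) _ ⟩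
          Σ (upTo d) (λ k → Σ xs (λ x → hit k r x)) ≡⟨ Σ-cong (upTo d) (λ {k} _ → trans
                                                          (Σ-single _ (proj₁ (proj₂ A-card)) (all∈ A-card (iter k r))
                                                            λ _ ne → indicator-no (_ ≟ _) (ne ∘ sym))
                                                          (indicator-yes (_ ≟ _) refl)) ⟩
          Σ (upTo d) (λ _ → 1)                      ≡⟨ Σ-const (upTo d) 1 ⟩
          length (upTo d) * 1                       ≡⟨ trans (*-identityʳ _) (length-upTo d) ⟩
          d                                         ∎

-- Polynomial identities with integer coefficients in a commutative ring

module IntegerSolver where

  open import Algebra.Bundles using (CommutativeRing)
  open import Algebra.Solver.Ring.AlmostCommutativeRing using (fromCommutativeRing; _-Raw-AlmostCommutative⟶_)
  open import Data.Integer as ℤ using (ℤ; +_; -[1+_]; _⊖_)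
  import Data.Integer.Properties as ℤ
  open import Data.Maybe as Maybe using ()
  open import Data.Nat as ℕ using (ℕ; zero; suc)
  open import Relation.Binary.Consequences using (dec⇒weaklyDec)
  open import Relation.Binary.PropositionalEquality as ≡ using (_≡_)

  module Solver {c ℓ} (R : CommutativeRing c ℓ) where
    open CommutativeRing R
    open import Algebra.Properties.Ring ring
    open import Algebra.Properties.AbelianGroup +-abelianGroup using (⁻¹-∙-comm)
    open import Algebra.Properties.Semiring.Mult.TCOptimised semiring
    open import Relation.Binary.Reasoning.Setoid setoid

    -- The canonical map from ℤ. With integer coefficients the solver cancels terms by deciding
    -- equality in ℤ, whatever the ring is.
    fromℤ : ℤ → Carrier
    fromℤ (+ n)      = n × 1#
    fromℤ (-[1+ n ]) = - (suc n × 1#)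

    fromℤ-neg : ∀ i → fromℤ (ℤ.- i) ≈ - fromℤ i
    fromℤ-neg (+ zero)   = sym -0#≈0#
    fromℤ-neg (+ suc n)  = refl
    fromℤ-neg (-[1+ n ]) = sym (-‿involutive _)

    fromℤ-⊖ : ∀ m n → fromℤ (m ⊖ n) ≈ m × 1# + - (n × 1#)
    fromℤ-⊖ zero    zero    = sym (-‿inverseʳ 0#)
    fromℤ-⊖ zero    (suc n) = sym (+-identityˡ _)
    fromℤ-⊖ (suc m) zero    = sym (trans (+-congˡ -0#≈0#) (+-identityʳ _))
    fromℤ-⊖ (suc m) (suc n) = begin
      fromℤ (suc m ⊖ suc n)                   ≡⟨ ≡.cong fromℤ (ℤ.[1+m]⊖[1+n]≡m⊖n m n) ⟩
      fromℤ (m ⊖ n)                           ≈⟨ fromℤ-⊖ m n ⟩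
      m × 1# + - (n × 1#)                     ≈⟨ +-congˡ (+-identityˡ _) ⟨
      m × 1# + (0# + - (n × 1#))              ≈⟨ +-congˡ (+-congʳ (-‿inverseʳ 1#)) ⟨
      m × 1# + (1# + - 1# + - (n × 1#))       ≈⟨ +-congˡ (trans (+-assoc 1# _ _) (+-congˡ (⁻¹-∙-comm 1# _))) ⟩
      m × 1# + (1# + - (1# + n × 1#))         ≈⟨ +-assoc _ _ _ ⟨
      m × 1# + 1# + - (1# + n × 1#)           ≈⟨ +-cong (+-comm _ 1#) refl ⟩
      1# + m × 1# + - (1# + n × 1#)           ≈⟨ +-cong (1+× m 1#) (-‿cong (1+× n 1#)) ⟨
      suc m × 1# + - (suc n × 1#)             ∎

    fromℤ-+ : ∀ i j → fromℤ (i ℤ.+ j) ≈ fromℤ i + fromℤ j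
    fromℤ-+ (+ m)      (+ n)      = ×-homo-+ 1# m n
    fromℤ-+ (+ m)      (-[1+ n ]) = fromℤ-⊖ m (suc n)
    fromℤ-+ (-[1+ m ]) (+ n)      = trans (fromℤ-⊖ n (suc m)) (+-comm _ _)
    fromℤ-+ (-[1+ m ]) (-[1+ n ]) = begin
      - (suc (suc (m ℕ.+ n)) × 1#)          ≡⟨ ≡.cong (λ k → - (suc k × 1#)) (ℕ.+-suc m n) ⟨
      - ((suc m ℕ.+ suc n) × 1#)            ≈⟨ -‿cong (×-homo-+ 1# (suc m) (suc n)) ⟩
      - (suc m × 1# + suc n × 1#)           ≈⟨ ⁻¹-∙-comm _ _ ⟨
      - (suc m × 1#) + - (suc n × 1#)       ∎
      where import Data.Nat.Properties as ℕ

    fromℤ-pos-* : ∀ m j → fromℤ (+ m ℤ.* j) ≈ fromℤ (+ m) * fromℤ j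
    fromℤ-pos-* m (+ n) = begin
      fromℤ (+ m ℤ.* + n)     ≡⟨ ≡.cong fromℤ (ℤ.pos-* m n) ⟨
      (m ℕ.* n) × 1#          ≈⟨ ×1-homo-* m n ⟩
      m × 1# * (n × 1#)       ∎
    fromℤ-pos-* m (-[1+ n ]) = begin
      fromℤ (+ m ℤ.* -[1+ n ])        ≡⟨ ≡.cong fromℤ (ℤ.neg-distribʳ-* (+ m) (+ suc n)) ⟨
      fromℤ (ℤ.- (+ m ℤ.* + suc n))   ≈⟨ fromℤ-neg (+ m ℤ.* + suc n) ⟩
      - fromℤ (+ m ℤ.* + suc n)       ≡⟨ ≡.cong (λ i → - fromℤ i) (ℤ.pos-* m (suc n)) ⟨
      - ((m ℕ.* suc n) × 1#)          ≈⟨ -‿cong (×1-homo-* m (suc n)) ⟩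
      - (m × 1# * (suc n × 1#))       ≈⟨ -‿distribʳ-* _ _ ⟩
      m × 1# * - (suc n × 1#)         ∎

    fromℤ-* : ∀ i j → fromℤ (i ℤ.* j) ≈ fromℤ i * fromℤ j
    fromℤ-* (+ m)      j = fromℤ-pos-* m j
    fromℤ-* (-[1+ m ]) j = begin
      fromℤ (-[1+ m ] ℤ.* j)          ≡⟨ ≡.cong fromℤ (ℤ.neg-distribˡ-* (+ suc m) j) ⟨
      fromℤ (ℤ.- (+ suc m ℤ.* j))     ≈⟨ fromℤ-neg (+ suc m ℤ.* j) ⟩
      - fromℤ (+ suc m ℤ.* j)         ≈⟨ -‿cong (fromℤ-pos-* (suc m) j) ⟩
      - (suc m × 1# * fromℤ j)        ≈⟨ -‿distribˡ-* _ _ ⟩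
      - (suc m × 1#) * fromℤ j        ∎

    homomorphism : ℤ.+-*-rawRing -Raw-AlmostCommutative⟶ fromCommutativeRing R
    homomorphism = record
      { ⟦_⟧    = fromℤ
      ; +-homo = fromℤ-+
      ; *-homo = fromℤ-*
      ; -‿homo = fromℤ-neg
      ; 0-homo = refl
      ; 1-homo = refl
      }

    open import Algebra.Solver.Ring ℤ.+-*-rawRing (fromCommutativeRing R) homomorphism
      (λ i j → Maybe.map (λ eq → reflexive (≡.cong fromℤ eq)) (dec⇒weaklyDec ℤ._≟_ i j)) public

-- Monic polynomials over a field, their roots, and Fermat's theorem for finite subfields

module Fields where

  open Counting
  open import Defs
  open IntegerSolver using (module Solver)
  open import Algebra.Structures using (IsCommutativeMonoid)
  open import Algebra.Bundles using (CommutativeRing; CommutativeMonoid)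
  import Algebra.Properties.CommutativeSemiring.Exp
  import Algebra.Properties.Monoid.Mult
  open import Data.Empty using (⊥-elim)
  import Data.Integer as ℤ
  open import Data.List using (List; []; _∷_; length; foldr; map)
  open import Data.List.Membership.Propositional using (_∈_)
  open import Data.List.Membership.Propositional.Properties using (∈-map⁺; ∈-map⁻)
  open import Data.List.Relation.Binary.Permutation.Propositional using (_↭_; ↭⇒↭ₛ)
  import Data.List.Relation.Binary.Permutation.Setoid.Properties as Permutation
  open import Data.List.Relation.Unary.All as All using (All; []; _∷_)
  open import Data.List.Relation.Unary.AllPairs using ([]; _∷_)
  open import Data.List.Relation.Unary.Any using (here; there)
  open import Data.List.Relation.Unary.Unique.Propositional using (Unique)
  open import Data.Nat as ℕ using (ℕ; zero; suc; _≤_; z≤n; s≤s)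
  import Data.Nat.Properties as ℕ
  open import Data.Product using (∃; _×_; _,_; proj₁; proj₂)
  open import Data.Sum using (inj₁; inj₂)
  open import Data.Unit using (tt)
  open import Data.Vec using (Vec; []; _∷_; _++_; replicate)
  open import Function using (_∘_; mk⇔; Equivalence)
  open import Relation.Binary.Definitions using (DecidableEquality)
  open import Relation.Binary.PropositionalEquality
  open import Relation.Nullary using (¬_; yes; no; ¬?)
  open import Relation.Nullary.Decidable using (decidable-stable)
  open import Relation.Unary using (U; _∩_; _∪_)

  open ≡-Reasoning

  module _ {A : Set} {_∙_ : A → A → A} {ε : A} (M : IsCommutativeMonoid _≡_ _∙_ ε) where
    open IsCommutativeMonoid M using (assoc; comm; identityˡ)

    private
      monoid = CommutativeMonoid.monoid (record { isCommutativeMonoid = M })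

    open Algebra.Properties.Monoid.Mult monoid using () renaming (_×_ to _times_)

    foldr-translate : ∀ a xs → foldr _∙_ ε (map (a ∙_) xs) ≡ (length xs times a) ∙ foldr _∙_ ε xs
    foldr-translate a []       = sym (identityˡ ε)
    foldr-translate a (x ∷ xs) = begin
      (a ∙ x) ∙ foldr _∙_ ε (map (a ∙_) xs)        ≡⟨ cong ((a ∙ x) ∙_) (foldr-translate a xs) ⟩
      (a ∙ x) ∙ (k ∙ f)                            ≡⟨ assoc a x _ ⟩
      a ∙ (x ∙ (k ∙ f))                            ≡⟨ cong (a ∙_) (trans (sym (assoc x k f)) (trans (cong (_∙ f) (comm x k)) (assoc k x f))) ⟩
      a ∙ (k ∙ (x ∙ f))                            ≡⟨ assoc a k _ ⟨
      (a ∙ k) ∙ (x ∙ f)                            ∎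
      where
      k = length xs times a
      f = foldr _∙_ ε xs

    -- Translation by a unit permutes a finite set that is stable under it.
    foldr-stable : ∀ {a b xs} → b ∙ a ≡ ε → Unique xs →
                   (∀ {x} → x ∈ xs → a ∙ x ∈ xs) → (∀ {x} → x ∈ xs → b ∙ x ∈ xs) →
                   foldr _∙_ ε xs ≡ (length xs times a) ∙ foldr _∙_ ε xs
    foldr-stable {a} {b} {xs} ba≡ε u a-stable b-stable = trans
      (Permutation.foldr-commMonoid (setoid A) M (↭⇒↭ₛ (unique-↭ u (unique-map (a ∙_) (λ _ _ → cancel) u)
        λ x → mk⇔
          (λ x∈ → subst (_∈ map (a ∙_) xs) (undo′ x) (∈-map⁺ (a ∙_) (b-stable x∈)))
          (λ x∈ → let y , y∈ , eq = ∈-map⁻ (a ∙_) x∈ in subst (_∈ xs) (sym eq) (a-stable y∈)))))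
      (foldr-translate a xs)
      where
      undo : ∀ x → b ∙ (a ∙ x) ≡ x
      undo x = trans (sym (assoc b a x)) (trans (cong (_∙ x) ba≡ε) (identityˡ x))
      undo′ : ∀ x → a ∙ (b ∙ x) ≡ x
      undo′ x = trans (sym (assoc a b x)) (trans (cong (_∙ x) (trans (comm a b) ba≡ε)) (identityˡ x))
      cancel : ∀ {x y} → a ∙ x ≡ a ∙ y → x ≡ y
      cancel {x} {y} eq = trans (sym (undo x)) (trans (cong (b ∙_) eq) (undo y))

  module FieldProperties (F : Field) where
    open Field F
    open CommutativeRing commutativeRing public
      using (+-assoc; +-comm; +-identityˡ; +-identityʳ; *-assoc; *-comm; *-identityˡ; *-identityʳ; zeroˡ; zeroʳ; -‿inverseˡ; -‿inverseʳ; commutativeSemiring; ring; +-isCommutativeMonoid; *-isCommutativeMonoid; +-monoid)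
    open Algebra.Properties.CommutativeSemiring.Exp commutativeSemiring public
    open Solver commutativeRing public using (Polynomial; solve; con; _:+_; _:*_; :-_; _:=_)

    :0 :1 : ∀ {n} → Polynomial n
    :0 = con (ℤ.+ 0)
    :1 = con (ℤ.+ 1)

    *-zero-product : ∀ {x y} → x ≢ 0# → x * y ≡ 0# → y ≡ 0#
    *-zero-product {x} {y} x≢0 xy≡0 with inverse x x≢0
    ... | x⁻¹ , xx⁻¹≡1 = begin
      y               ≡⟨ *-identityˡ y ⟨
      1# * y          ≡⟨ cong (_* y) xx⁻¹≡1 ⟨
      x * x⁻¹ * y     ≡⟨ solve 3 (λ x z y → x :* z :* y := z :* (x :* y)) refl x x⁻¹ y ⟩
      x⁻¹ * (x * y)   ≡⟨ cong (x⁻¹ *_) xy≡0 ⟩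
      x⁻¹ * 0#        ≡⟨ zeroʳ x⁻¹ ⟩
      0#              ∎

    x-y≡0⇒x≡y : ∀ {x y} → x + - y ≡ 0# → x ≡ y
    x-y≡0⇒x≡y {x} {y} eq = begin
      x             ≡⟨ solve 2 (λ x y → x := x :+ :- y :+ y) refl x y ⟩
      x + - y + y   ≡⟨ cong (_+ y) eq ⟩
      0# + y        ≡⟨ +-identityˡ y ⟩
      y             ∎

    x≡y⇒x-y≡0 : ∀ {x y} → x ≡ y → x + - y ≡ 0#
    x≡y⇒x-y≡0 refl = -‿inverseʳ _

    *-cancelˡ : ∀ {x y z} → x ≢ 0# → x * y ≡ x * z → y ≡ z
    *-cancelˡ {x} {y} {z} x≢0 eq = x-y≡0⇒x≡y (*-zero-product x≢0
      (trans (solve 3 (λ x y z → x :* (y :+ :- z) := x :* y :+ :- (x :* z)) refl x y z) (x≡y⇒x-y≡0 eq)))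

    *-nonzero : ∀ {x y} → x ≢ 0# → y ≢ 0# → x * y ≢ 0#
    *-nonzero x≢0 y≢0 = y≢0 ∘ *-zero-product x≢0

    1^ : ∀ k → 1# ^ k ≡ 1#
    1^ zero    = refl
    1^ (suc k) = trans (*-identityˡ _) (1^ k)

    -- Horner's scheme: the coefficients of the quotient are the values at r of the tails of the
    -- polynomial, and the remainder is its value at r.
    divide : ∀ {d} (cs : Vec Carrier (suc d)) r → ∃ λ (qs : Vec Carrier d) →
             ∀ x → evalMonic F cs x ≡ (x + - r) * evalMonic F qs x + evalMonic F cs r
    divide (c ∷ [])            r = [] , λ x →
      solve 3 (λ c x r → c :+ x :* :1 := (x :+ :- r) :* :1 :+ (c :+ r :* :1)) refl c x r
    divide (c ∷ cs@(_ ∷ _)) r with divide cs r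
    ... | qs , eq = evalMonic F cs r ∷ qs , λ x → trans (cong (λ y → c + x * y) (eq x))
      (solve 5 (λ c x r g e → c :+ x :* ((x :+ :- r) :* g :+ e) := (x :+ :- r) :* (e :+ x :* g) :+ (c :+ r :* e))
        refl c x r (evalMonic F qs x) (evalMonic F cs r))

    root-bound : ∀ {d} (cs : Vec Carrier d) {rs} → Unique rs →
                 (∀ {r} → r ∈ rs → evalMonic F cs r ≡ 0#) → length rs ≤ d
    root-bound cs [] roots = z≤n
    root-bound [] {_ ∷ _} u roots = ⊥-elim (0≢1 (sym (roots (here refl))))
    root-bound cs@(_ ∷ _) {r ∷ rs} (r∉ ∷ u) roots with divide cs r
    ... | qs , eq = s≤s (root-bound qs u λ {x} x∈ → *-zero-product
      (λ x-r≡0 → All.lookup r∉ x∈ (sym (x-y≡0⇒x≡y x-r≡0)))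
      (begin
        (x + - r) * evalMonic F qs x                     ≡⟨ +-identityʳ _ ⟨
        (x + - r) * evalMonic F qs x + 0#                ≡⟨ cong ((x + - r) * evalMonic F qs x +_) (roots (here refl)) ⟨
        (x + - r) * evalMonic F qs x + evalMonic F cs r  ≡⟨ eq x ⟨
        evalMonic F cs x                                 ≡⟨ roots (there x∈) ⟩
        0#                                               ∎))

    root-card-bound : ∀ {d k} (cs : Vec Carrier d) {P} → HasCard P k → (∀ {x} → P x → evalMonic F cs x ≡ 0#) → k ≤ d
    root-card-bound cs (rs , u , refl , rs⇔) roots = root-bound cs u (roots ∘ Equivalence.to (rs⇔ _))

    evalMonic-X^ : ∀ k x → evalMonic F (replicate k 0#) x ≡ x ^ k
    evalMonic-X^ zero    x = refl
    evalMonic-X^ (suc k) x = trans (+-identityˡ _) (cong (x *_) (evalMonic-X^ k x))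

    evalMonic-shift : ∀ k {d} (cs : Vec Carrier d) x → evalMonic F (replicate k 0# ++ cs) x ≡ x ^ k * evalMonic F cs x
    evalMonic-shift zero    cs x = sym (*-identityˡ _)
    evalMonic-shift (suc k) cs x = trans (+-identityˡ _)
      (trans (cong (x *_) (evalMonic-shift k cs x)) (sym (*-assoc x _ _)))

    -- X^(k+1) - 1
    unityPoly : ∀ k → Vec Carrier (suc k)
    unityPoly k = - 1# ∷ replicate k 0#

    unityPoly-root : ∀ k {x} → x ^ suc k ≡ 1# → evalMonic F (unityPoly k) x ≡ 0#
    unityPoly-root k {x} eq = trans (cong (λ y → - 1# + x * y) (evalMonic-X^ k x)) (trans (cong (- 1# +_) eq) (-‿inverseˡ 1#))

    -- 1 + X^(k+1) + X^(2(k+1)) + … + X^(s(k+1))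
    geometric : ∀ k s → Vec Carrier (s ℕ.* suc k)
    geometric k zero    = []
    geometric k (suc s) = 1# ∷ (replicate k 0# ++ geometric k s)

    geometric-sum : ∀ k s x → (x ^ suc k + - 1#) * evalMonic F (geometric k s) x ≡ (x ^ suc k) ^ suc s + - 1#
    geometric-sum k zero    x = solve 1 (λ y → (y :+ :- :1) :* :1 := y :* :1 :+ :- :1) refl (x ^ suc k)
    geometric-sum k (suc s) x = begin
      (x * x ^ k + - 1#) * (1# + x * evalMonic F (replicate k 0# ++ geometric k s) x)
        ≡⟨ cong (λ y → (x * x ^ k + - 1#) * (1# + x * y)) (evalMonic-shift k (geometric k s) x) ⟩
      (x * x ^ k + - 1#) * (1# + x * (x ^ k * g))
        ≡⟨ solve 3 (λ x y g → (x :* y :+ :- :1) :* (:1 :+ x :* (y :* g)) :=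
                              x :* y :+ :- :1 :+ x :* y :* ((x :* y :+ :- :1) :* g)) refl x (x ^ k) g ⟩
      x * x ^ k + - 1# + x * x ^ k * ((x * x ^ k + - 1#) * g)
        ≡⟨ cong (λ y → x * x ^ k + - 1# + x * x ^ k * y) (geometric-sum k s x) ⟩
      x * x ^ k + - 1# + x * x ^ k * ((x ^ suc k) ^ suc s + - 1#)
        ≡⟨ solve 2 (λ y z → y :+ :- :1 :+ y :* (z :+ :- :1) := y :* z :+ :- :1) refl (x ^ suc k) ((x ^ suc k) ^ suc s) ⟩
      x ^ suc k * (x ^ suc k) ^ suc s + - 1# ∎
      where g = evalMonic F (geometric k s) x

    -- Adds a constant to a monic polynomial. The degree is at least one, because the leading
    -- coefficient is implicit and must stay 1.
    addHead : ∀ {d} → Carrier → Vec Carrier (suc d) → Vec Carrier (suc d)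
    addHead c (v ∷ vs) = c + v ∷ vs

    -- Multiplication by X - r, following (X - r)(c + XP) = -rc + X(c + (X - r)P).
    mulLinear : ∀ {d} → Carrier → Vec Carrier d → Vec Carrier (suc d)
    mulLinear r []       = - r ∷ []
    mulLinear r (c ∷ cs) = - (r * c) ∷ addHead c (mulLinear r cs)

    evalMonic-addHead : ∀ {d} c (vs : Vec Carrier (suc d)) x → evalMonic F (addHead c vs) x ≡ c + evalMonic F vs x
    evalMonic-addHead c (v ∷ vs) x = +-assoc c v _

    evalMonic-mulLinear : ∀ {d} r (cs : Vec Carrier d) x →
                          evalMonic F (mulLinear r cs) x ≡ (x + - r) * evalMonic F cs x
    evalMonic-mulLinear r []       x = solve 2 (λ r x → :- r :+ x :* :1 := (x :+ :- r) :* :1) refl r x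
    evalMonic-mulLinear r (c ∷ cs) x = begin
      - (r * c) + x * evalMonic F (addHead c (mulLinear r cs)) x
        ≡⟨ cong (λ y → - (r * c) + x * y) (trans (evalMonic-addHead c (mulLinear r cs) x) (cong (c +_) (evalMonic-mulLinear r cs x))) ⟩
      - (r * c) + x * (c + (x + - r) * evalMonic F cs x)
        ≡⟨ solve 4 (λ r c x e → :- (r :* c) :+ x :* (c :+ (x :+ :- r) :* e) := (x :+ :- r) :* (c :+ x :* e)) refl r c x _ ⟩
      (x + - r) * (c + x * evalMonic F cs x) ∎

    private
      -- Adds cX. This is the linear part in (X - r)(P + c) = (X - r)P + cX - rc; degree at least
      -- two again protects the leading coefficient.
      addSecond : ∀ {d} → Carrier → Vec Carrier (suc (suc d)) → Vec Carrier (suc (suc d))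
      addSecond c (u ∷ v ∷ vs) = u ∷ c + v ∷ vs

      addHead-comm : ∀ {d} b c (vs : Vec Carrier (suc d)) → addHead b (addHead c vs) ≡ addHead c (addHead b vs)
      addHead-comm b c (v ∷ vs) = cong (_∷ vs) (solve 3 (λ b c v → b :+ (c :+ v) := c :+ (b :+ v)) refl b c v)

      mulLinear-addHead : ∀ {d} r c (vs : Vec Carrier (suc d)) →
                          mulLinear r (addHead c vs) ≡ addHead (- (r * c)) (addSecond c (mulLinear r vs))
      mulLinear-addHead r c (v ∷ vs) with mulLinear r vs
      ... | w ∷ ws = cong₂ (λ y z → y ∷ z ∷ ws)
        (solve 3 (λ r c v → :- (r :* (c :+ v)) := :- (r :* c) :+ :- (r :* v)) refl r c v) (+-assoc c v w)

    -- An equation between coefficients, since over a finite field equal values everywhere do not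
    -- make polynomials equal. It serves to show that σ fixes the coefficients of the product over
    -- an orbit.
    mulLinear-comm : ∀ {d} r s (cs : Vec Carrier d) → mulLinear r (mulLinear s cs) ≡ mulLinear s (mulLinear r cs)
    mulLinear-comm r s [] = cong₂ (λ y z → y ∷ z ∷ [])
      (solve 2 (λ r s → :- (r :* :- s) := :- (s :* :- r)) refl r s) (+-comm _ _)
    mulLinear-comm r s (c ∷ cs) = cong₂ _∷_
      (solve 3 (λ r s c → :- (r :* :- (s :* c)) := :- (s :* :- (r :* c))) refl r s c) (begin
        addHead (- (s * c)) (mulLinear r (addHead c (mulLinear s cs)))
          ≡⟨ cong (addHead (- (s * c))) (mulLinear-addHead r c (mulLinear s cs)) ⟩
        addHead (- (s * c)) (addHead (- (r * c)) (addSecond c (mulLinear r (mulLinear s cs))))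
          ≡⟨ addHead-comm _ _ (addSecond c (mulLinear r (mulLinear s cs))) ⟩
        addHead (- (r * c)) (addHead (- (s * c)) (addSecond c (mulLinear r (mulLinear s cs))))
          ≡⟨ cong (λ v → addHead (- (r * c)) (addHead (- (s * c)) (addSecond c v))) (mulLinear-comm r s cs) ⟩
        addHead (- (r * c)) (addHead (- (s * c)) (addSecond c (mulLinear s (mulLinear r cs))))
          ≡⟨ cong (addHead (- (r * c))) (mulLinear-addHead s c (mulLinear r cs)) ⟨
        addHead (- (r * c)) (mulLinear s (addHead c (mulLinear r cs))) ∎)

    product : List Carrier → Carrier
    product = foldr _*_ 1#

    product-nonzero : ∀ xs → (∀ {x} → x ∈ xs → x ≢ 0#) → product xs ≢ 0#
    product-nonzero []       _   = 0≢1 ∘ sym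
    product-nonzero (x ∷ xs) ne = *-nonzero (ne (here refl)) (product-nonzero xs (ne ∘ there))

    open Algebra.Properties.Monoid.Mult +-monoid
      public using () renaming (_×_ to _times_)

    -- Adding 1 permutes the field, so the sum S of all its elements satisfies S = n·1 + S, and S
    -- cancels.
    card-times-1 : ∀ {n} → HasCard {Carrier} U n → n times 1# ≡ 0#
    card-times-1 F-card@(xs , u , refl , xs⇔) = begin
      length xs times 1#             ≡⟨ solve 2 (λ a s → a := a :+ s :+ :- s) refl _ S ⟩
      length xs times 1# + S + - S   ≡⟨ cong (_+ - S) (foldr-stable +-isCommutativeMonoid (-‿inverseˡ 1#) u (λ _ → all∈ F-card _) (λ _ → all∈ F-card _)) ⟨
      S + - S                        ≡⟨ -‿inverseʳ S ⟩
      0#                             ∎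
      where S = foldr _+_ 0# xs

    module _ (_≟_ : DecidableEquality Carrier) (K : Subfield F) where
      open Subfield K

      private
        NonzeroMember : Carrier → Set
        NonzeroMember = Member ∩ (_≢ 0#)

      nonzero-card : ∀ {q} → HasCard Member (suc q) → HasCard NonzeroMember q
      nonzero-card K-card with card-delete _≟_ 0-closed K-card
      ... | _ , refl , card = card

      -- Multiplication by x permutes the nonzero members of `K`, so their product P satisfies P =
      -- x^q P, and P cancels. Here `q` is the number of nonzero members.
      fermat-unit : ∀ {q} → HasCard Member (suc q) → ∀ {x} → Member x → x ≢ 0# → x ^ q ≡ 1#
      fermat-unit K-card {x} x∈K x≢0 with nonzero-card K-card | inverse x x≢0
      ... | xs , u , refl , xs⇔ | x⁻¹ , eq = *-cancelˡ
        (product-nonzero xs (proj₂ ∘ to (xs⇔ _)))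
        (trans (*-comm _ _) (trans (sym (foldr-stable *-isCommutativeMonoid (trans (*-comm x⁻¹ x) eq) u
            (stable x∈K x≢0) (stable (inv-closed x∈K eq) x⁻¹≢0))) (sym (*-identityʳ _))))
        where
        open Equivalence
        x⁻¹≢0 : x⁻¹ ≢ 0#
        x⁻¹≢0 refl = 0≢1 (trans (sym (zeroʳ x)) eq)
        stable : ∀ {y} → Member y → y ≢ 0# → ∀ {z} → z ∈ xs → y * z ∈ xs
        stable y∈K y≢0 z∈ = let z∈K , z≢0 = to (xs⇔ _) z∈ in from (xs⇔ _) (*-closed y∈K z∈K , *-nonzero y≢0 z≢0)

      fermat : ∀ {q} → HasCard Member q → ∀ {x} → Member x → x ^ q ≡ x
      fermat K-card {x} x∈K with card-delete _≟_ 0-closed K-card | x ≟ 0#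
      ... | _ , refl , _ | yes refl = zeroˡ _
      ... | _ , refl , _ | no  x≢0  = trans (cong (x *_) (fermat-unit K-card x∈K x≢0)) (*-identityʳ x)

      -- If x were outside `K`, then x together with the units of `K` would be one root too many for
      -- X^(q-1) - 1. The second deletion, of 1, exposes q as k + 2, so that this polynomial is
      -- `unityPoly k`.
      fermat-converse : ∀ {q} → HasCard Member q → ∀ {x} → x ^ q ≡ x → Member x
      fermat-converse K-card {x} xᑫ≡x with card-delete _≟_ 0-closed K-card
      ... | _ , refl , K*-card with card-delete _≟_ (1-closed , 0≢1 ∘ sym) K*-card
      ... | k , refl , _ = decidable-stable (card⇒decidable _≟_ K-card x) λ x∉K →
        let x≢0 : x ≢ 0#
            x≢0 x≡0 = x∉K (subst Member (sym x≡0) 0-closed)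
        in ℕ.1+n≰n (root-card-bound (unityPoly k)
             (card-∪ (λ x≡y (y∈K , _) → x∉K (subst Member x≡y y∈K)) (card-singleton x) K*-card)
             λ where
               (inj₁ refl)        → unityPoly-root k (*-cancelˡ x≢0 (trans xᑫ≡x (sym (*-identityʳ x))))
               (inj₂ (y∈K , y≢0)) → unityPoly-root k (fermat-unit K-card y∈K y≢0))

    wholeField : Subfield F
    wholeField = record
      { Member = U ; 0-closed = tt ; 1-closed = tt ; +-closed = λ _ _ → tt ; *-closed = λ _ _ → tt
      ; neg-closed = λ _ → tt ; inv-closed = λ _ _ → tt }

    -- The polynomial X^s′k′ - 1 splits in F, where k′ = k+1 and s′ = s+1; since
    -- its cofactor has at most sk′ roots, X^k′ - 1 has all its k′ roots in F.
    frobenius-fixed-card : ∀ k s → HasCard {Carrier} U (suc (suc s ℕ.* suc k)) →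
                           HasCard (λ x → x ^ suc (suc k) ≡ x) (suc (suc k))
    frobenius-fixed-card k s F-card = card-≐ (to , from) (card-∪ (λ y≡0 (ne , _) → proj₂ ne y≡0) (card-singleton 0#) roots)
      where
      infix 4 _≟_
      _≟_ = finite⇒≟ F-card

      units : HasCard (U ∩ (_≢ 0#)) (suc s ℕ.* suc k)
      units = nonzero-card _≟_ wholeField F-card

      A-card = card-filter (λ x → x ^ suc k ≟ 1#) units
      B-card = card-filter (λ x → ¬? (x ^ suc k ≟ 1#)) units

      a = proj₁ A-card
      b = proj₁ B-card

      a+b : a ℕ.+ b ≡ suc s ℕ.* suc k
      a+b = card-unique (card-≐ ((λ where (inj₁ p) → proj₁ p ; (inj₂ p) → proj₁ p) , split)
              (card-∪ (λ (_ , eq) (_ , ne) → ne eq) (proj₂ A-card) (proj₂ B-card))) units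
        where
        split : ∀ {x} → (U ∩ (_≢ 0#)) x → (((U ∩ (_≢ 0#)) ∩ λ x → x ^ suc k ≡ 1#) ∪ ((U ∩ (_≢ 0#)) ∩ λ x → x ^ suc k ≢ 1#)) x
        split {x} px with x ^ suc k ≟ 1#
        ... | yes eq = inj₁ (px , eq)
        ... | no  ne = inj₂ (px , ne)

      a≤ : a ≤ suc k
      a≤ = root-card-bound (unityPoly k) (proj₂ A-card) (unityPoly-root k ∘ proj₂)

      b≤ : b ≤ s ℕ.* suc k
      -- Every unit x satisfies x^((s+1)(k+1)) = 1, so the factors x^(k+1) - 1 and `geometric` have
      -- product zero at x. In the second set the first factor is nonzero.
      b≤ = root-card-bound (geometric k s) (proj₂ B-card) λ {x} ((_ , x≢0) , ne) →
        *-zero-product (ne ∘ x-y≡0⇒x≡y) (trans (geometric-sum k s x) (x≡y⇒x-y≡0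
          (trans (^-assocʳ x (suc k) (suc s)) (trans (cong (x ^_) (ℕ.*-comm (suc k) (suc s)))
            (fermat-unit _≟_ wholeField F-card tt x≢0)))))

      a≡ : a ≡ suc k
      a≡ = ℕ.≤-antisym a≤ (ℕ.+-cancelʳ-≤ b (suc k) a
        (ℕ.≤-trans (ℕ.+-monoʳ-≤ (suc k) b≤) (ℕ.≤-reflexive (sym a+b))))

      roots : HasCard ((U ∩ (_≢ 0#)) ∩ λ x → x ^ suc k ≡ 1#) (suc k)
      roots = subst (HasCard _) a≡ (proj₂ A-card)

      to : ∀ {x} → ((_≡ 0#) ∪ ((U ∩ (_≢ 0#)) ∩ λ x → x ^ suc k ≡ 1#)) x → x ^ suc (suc k) ≡ x
      to     (inj₁ refl)     = zeroˡ _
      to {x} (inj₂ (_ , eq)) = trans (cong (x *_) eq) (*-identityʳ x)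

      from : ∀ {x} → x ^ suc (suc k) ≡ x → ((_≡ 0#) ∪ ((U ∩ (_≢ 0#)) ∩ λ x → x ^ suc k ≡ 1#)) x
      from {x} eq with x ≟ 0#
      ... | yes x≡0 = inj₁ x≡0
      ... | no  x≢0 = inj₂ ((tt , x≢0) , *-cancelˡ x≢0 (trans eq (sym (*-identityʳ x))))

-- The map x ↦ x^q: additivity, fixed points, conjugates and minimal polynomials

module Frobenius where

  open Counting
  open import Defs
  open Fields using (module FieldProperties)
  open Orbits using (module CyclicOrbits; least)
  open import Algebra.Bundles using (CommutativeRing)
  open import Algebra.Morphism.Structures using (module RingMorphisms)
  import Algebra.Morphism.Construct.Composition as Composition
  import Algebra.Morphism.Construct.Identity as Identity
  import Algebra.Properties.CommutativeSemiring.Binomial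
  import Algebra.Properties.Monoid.Sum
  import Algebra.Properties.Semiring.Mult
  open import Data.Fin using (fromℕ; inject₁) renaming (zero to fzero; suc to fsuc)
  open import Data.Fin.Properties using (toℕ-fromℕ; toℕ-inject₁; toℕ<n)
  open import Data.Nat as ℕ using (ℕ; zero; suc; _∸_; _≤_; _<_; z≤n; s≤s; NonZero; _!)
  open import Data.Nat.Combinatorics using (_C_; nCn≡1; k![n∸k]!∣n!)
  open import Data.Nat.Combinatorics.Specification using (nCk≡n!/k![n-k]!)
  open import Data.Nat.Divisibility using (_∣_; divides; ∣⇒≤; m∣m*n)
  open import Data.Nat.DivMod using (m/n*n≡m)
  open import Data.Nat.GCD using (gcd; gcd-GCD; gcd[m,n]∣m; gcd[m,n]∣n; module Bézout)
  open import Data.Nat.Primality using (Prime; euclidsLemma; prime⇒nonZero; prime⇒nonTrivial)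
  import Data.Nat.Properties as ℕ
  open import Data.Nat.Solver using () renaming (module +-*-Solver to ℕSolver)
  open import Data.Product using (∃; _×_; _,_; proj₁; proj₂)
  open import Data.Sum using (inj₁; inj₂)
  open import Data.Unit using (tt)
  open import Data.Vec using (Vec; []; _∷_; map)
  open import Data.Vec.Properties using (∷-injectiveˡ; ∷-injectiveʳ)
  open import Data.Vec.Relation.Unary.All using (All; []; _∷_)
  open import Function using (_∘_)
  open import Relation.Binary.PropositionalEquality
  open import Relation.Nullary using (Dec; yes; no; contradiction)
  open import Relation.Unary using (U; _≐_)

  open ≡-Reasoning

  prime∣!⇒≤ : ∀ {p} → Prime p → ∀ m → p ∣ m ! → p ≤ m
  prime∣!⇒≤ {p} p-prime zero    p∣1 = contradiction (∣⇒≤ p∣1) (ℕ.<⇒≱ (ℕ.nonTrivial⇒n>1 p {{prime⇒nonTrivial p-prime}}))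
  prime∣!⇒≤ p-prime (suc m) p∣ with euclidsLemma (suc m) (m !) p-prime p∣
  ... | inj₁ p∣1+m = ∣⇒≤ p∣1+m
  ... | inj₂ p∣m!  = ℕ.m≤n⇒m≤1+n (prime∣!⇒≤ p-prime m p∣m!)

  -- p divides p!, the product of the binomial coefficient with k! and (p - k)!, but divides neither
  -- factorial, as both k and p - k are smaller than p.
  prime∣C : ∀ {p k} → Prime p → 0 < k → k < p → p ∣ p C k
  prime∣C {suc p} {k} p-prime 0<k k<p with euclidsLemma (suc p C k) (k ! ℕ.* (suc p ∸ k) !) p-prime
      (subst (suc p ∣_) (sym split) (m∣m*n (p !)))
    where
    instance
      denominator≢0 : NonZero (k ! ℕ.* (suc p ∸ k) !)
      denominator≢0 = ℕ._!*_!≢0 k (suc p ∸ k)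
    split : (suc p C k) ℕ.* (k ! ℕ.* (suc p ∸ k) !) ≡ suc p !
    split = trans (cong (ℕ._* (k ! ℕ.* (suc p ∸ k) !)) (nCk≡n!/k![n-k]! (ℕ.<⇒≤ k<p))) (m/n*n≡m (k![n∸k]!∣n! (ℕ.<⇒≤ k<p)))
  ... | inj₁ p∣C = p∣C
  ... | inj₂ p∣k![p-k]! with euclidsLemma (k !) _ p-prime p∣k![p-k]!
  ... | inj₁ p∣k!     = contradiction (prime∣!⇒≤ p-prime k p∣k!) (ℕ.<⇒≱ k<p)
  ... | inj₂ p∣[p-k]! = contradiction (prime∣!⇒≤ p-prime _ p∣[p-k]!) (ℕ.<⇒≱ (ℕ.∸-monoʳ-< 0<k (ℕ.<⇒≤ k<p)))

  module Characteristic (F : Field) {p : ℕ} (p-prime : Prime p) where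
    open Field F
    open FieldProperties F
    open CommutativeRing commutativeRing using (semiring)
    open Algebra.Properties.Semiring.Mult semiring
      using (×-assoc-*; ×1-homo-*)
    open Algebra.Properties.Monoid.Sum +-monoid using (sum; sum-init-last; sum-cong-≗; sum-replicate-zero)
    module Binomial = Algebra.Properties.CommutativeSemiring.Binomial commutativeSemiring

    -- The order p^e of the field annihilates 1, and m ↦ m·1 is multiplicative. As a field has no
    -- zero divisors, one of the factors p·1 must vanish.
    card⇒characteristic : ∀ e → HasCard {Carrier} U (p ℕ.^ e) → p times 1# ≡ 0#
    card⇒characteristic e F-card = decide e (card-times-1 F-card)
      where
      infix 4 _≟_
      _≟_ = finite⇒≟ F-card
      decide : ∀ e → (p ℕ.^ e) times 1# ≡ 0# → p times 1# ≡ 0#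
      decide zero    eq = contradiction (trans (sym eq) (+-identityʳ 1#)) 0≢1
      decide (suc e) eq with p times 1# ≟ 0#
      ... | yes p×1≡0 = p×1≡0
      ... | no  p×1≢0 = decide e (*-zero-product p×1≢0 (trans (sym (×1-homo-* p (p ℕ.^ e))) eq))

    module _ (p×1≡0 : p times 1# ≡ 0#) where

      multiple-times : ∀ {k} → p ∣ k → ∀ x → k times x ≡ 0#
      multiple-times (divides m refl) x = begin
        (m ℕ.* p) times x           ≡⟨ cong ((m ℕ.* p) times_) (*-identityˡ x) ⟨
        (m ℕ.* p) times (1# * x)    ≡⟨ ×-assoc-* (m ℕ.* p) 1# x ⟨
        (m ℕ.* p) times 1# * x      ≡⟨ cong (_* x) (×1-homo-* m p) ⟩
        m times 1# * (p times 1#) * x ≡⟨ cong (λ y → m times 1# * y * x) p×1≡0 ⟩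
        m times 1# * 0# * x         ≡⟨ cong (_* x) (zeroʳ _) ⟩
        0# * x                      ≡⟨ zeroˡ x ⟩
        0#                          ∎

      -- In the binomial expansion p divides every coefficient but the first and the last. The
      -- exponent is generalised in `helper` so that it can be matched as a successor, which lets
      -- both end terms split off.
      frobenius-+ : ∀ x y → (x + y) ^ p ≡ x ^ p + y ^ p
      frobenius-+ x y = helper p refl
        where
        helper : ∀ p′ → p ≡ p′ → (x + y) ^ p′ ≡ x ^ p′ + y ^ p′
        helper zero    eq = contradiction (sym eq) (ℕ.≢-nonZero⁻¹ p {{prime⇒nonZero p-prime}} ∘ sym)
        helper (suc m) refl = begin
          (x + y) ^ suc m                             ≡⟨ Binomial.theorem (suc m) x y ⟩
          t fzero + sum (t ∘ fsuc)                    ≡⟨ cong (t fzero +_) (sum-init-last (t ∘ fsuc)) ⟩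
          t fzero + (sum (λ i → t (fsuc (inject₁ i))) + t (fsuc (fromℕ m)))
            ≡⟨ cong₂ (λ u v → t fzero + (u + v)) (trans (sum-cong-≗ middle) (sum-replicate-zero m)) top ⟩
          t fzero + (0# + x ^ suc m)                  ≡⟨ cong₂ _+_ bottom (+-identityˡ _) ⟩
          y ^ suc m + x ^ suc m                       ≡⟨ +-comm _ _ ⟩
          x ^ suc m + y ^ suc m                       ∎
          where
          t = Binomial.binomialTerm x y (suc m)

          bottom : t fzero ≡ y ^ suc m
          bottom = trans (+-identityʳ _) (*-identityˡ _)

          top : t (fsuc (fromℕ m)) ≡ x ^ suc m
          top = begin
            t (fsuc (fromℕ m)) ≡⟨ cong (λ j → (suc m C suc j) times (x ^ suc j * y ^ (m ∸ j))) (toℕ-fromℕ m) ⟩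
            (suc m C suc m) times (x ^ suc m * y ^ (m ∸ m)) ≡⟨ cong₂ (λ j k → j times (x ^ suc m * y ^ k)) (nCn≡1 (suc m)) (ℕ.n∸n≡0 m) ⟩
            x ^ suc m * 1# + 0# ≡⟨ trans (+-identityʳ _) (*-identityʳ _) ⟩
            x ^ suc m ∎

          middle : ∀ i → t (fsuc (inject₁ i)) ≡ 0#
          middle i = multiple-times (prime∣C p-prime (s≤s z≤n)
            (s≤s (subst (_< m) (sym (toℕ-inject₁ i)) (toℕ<n i)))) _

      frobenius^-+ : ∀ e x y → (x + y) ^ (p ℕ.^ e) ≡ x ^ (p ℕ.^ e) + y ^ (p ℕ.^ e)
      frobenius^-+ zero    x y = trans (*-identityʳ _) (sym (cong₂ _+_ (*-identityʳ x) (*-identityʳ y)))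
      frobenius^-+ (suc e) x y = begin
        (x + y) ^ (p ℕ.* p ℕ.^ e)                   ≡⟨ ^-assocʳ (x + y) p (p ℕ.^ e) ⟨
        ((x + y) ^ p) ^ (p ℕ.^ e)                   ≡⟨ cong (_^ (p ℕ.^ e)) (frobenius-+ x y) ⟩
        (x ^ p + y ^ p) ^ (p ℕ.^ e)                 ≡⟨ frobenius^-+ e (x ^ p) (y ^ p) ⟩
        (x ^ p) ^ (p ℕ.^ e) + (y ^ p) ^ (p ℕ.^ e)   ≡⟨ cong₂ _+_ (^-assocʳ x p _) (^-assocʳ y p _) ⟩
        x ^ (p ℕ.* p ℕ.^ e) + y ^ (p ℕ.* p ℕ.^ e)   ∎

  -- The exponents are those of frobenius-fixed-card.
  power-shape : ∀ k m → ∃ λ s → suc (suc k) ℕ.^ suc m ≡ suc (suc s ℕ.* suc k)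
  power-shape k zero    = 0 , cong (suc ∘ suc) (ℕ.*-comm k 1)
  power-shape k (suc m) with power-shape k m
  ... | s , eq = suc (suc k) ℕ.* suc s , trans (cong (suc (suc k) ℕ.*_) eq)
    (ℕSolver.solve 2 (λ k s → (con 2 :+ k) :* (con 1 :+ (con 1 :+ s) :* (con 1 :+ k)) :=
      con 1 :+ (con 1 :+ (con 2 :+ k) :* (con 1 :+ s)) :* (con 1 :+ k)) refl k s)
    where open ℕSolver using (con; _:+_; _:*_; _:=_)

  module GaloisElement (F : Field) (K : Subfield F) {φ : Field.Carrier F → Field.Carrier F} (φ∈Gal : Gal F K φ) where
    open Field F
    open Subfield K using (Member)
    open RingMorphisms rawRing rawRing using (module IsRingIsomorphism)
    open IsRingIsomorphism (proj₁ φ∈Gal) public using (+-homo; *-homo; 0#-homo; 1#-homo; injective)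

    evalMonic-homo : ∀ {e} (cs : Vec Carrier e) → All Member cs → ∀ x → φ (evalMonic F cs x) ≡ evalMonic F cs (φ x)
    evalMonic-homo []       []              x = 1#-homo
    evalMonic-homo (c ∷ cs) (c∈K ∷ cs∈K) x =
      trans (+-homo c _) (cong₂ _+_ (proj₂ φ∈Gal c∈K) (trans (*-homo x _) (cong (φ x *_) (evalMonic-homo cs cs∈K x))))

  module GaloisGroup (F : Field) {p : ℕ} (p-prime : Prime p) (ω d : ℕ) .{{ω≢0 : NonZero ω}} .{{d≢0 : NonZero d}}
                (F-card : HasCard {Field.Carrier F} U ((p ℕ.^ ω) ℕ.^ d))
                (K : Subfield F) (K-card : HasCard (Subfield.Member K) (p ℕ.^ ω)) where
    open Field F
    open FieldProperties F
    open Subfield K using (Member)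
    open RingMorphisms rawRing rawRing using (IsRingIsomorphism)

    q : ℕ
    q = p ℕ.^ ω

    infix 4 _≟_
    _≟_ = finite⇒≟ F-card

    σ : Carrier → Carrier
    σ x = x ^ q

    open CyclicOrbits F-card σ d public

    iter≡^ : ∀ k x → iter k x ≡ x ^ (q ℕ.^ k)
    iter≡^ zero    x = sym (*-identityʳ x)
    iter≡^ (suc k) x = trans (cong σ (iter≡^ k x)) (trans (^-assocʳ x (q ℕ.^ k) q) (cong (x ^_) (ℕ.*-comm (q ℕ.^ k) q)))

    σᵈ≡id : ∀ x → iter d x ≡ x
    σᵈ≡id x = trans (iter≡^ d x) (fermat _≟_ wholeField F-card tt)

    p×1≡0 : p times 1# ≡ 0#
    p×1≡0 = Characteristic.card⇒characteristic F p-prime (ω ℕ.* d) (subst (HasCard U) (ℕ.^-*-assoc p ω d) F-card)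

    σ-+ : ∀ x y → σ (x + y) ≡ σ x + σ y
    σ-+ = Characteristic.frobenius^-+ F p-prime p×1≡0 ω

    q-shape : ∃ λ k → q ≡ suc (suc k)
    q-shape with card-delete _≟_ (Subfield.0-closed K) K-card
    ... | _ , eq , K*-card with card-delete _≟_ (Subfield.1-closed K , 0≢1 ∘ sym) K*-card
    ... | k , refl , _ = k , eq

    σ-0 : σ 0# ≡ 0#
    σ-0 with k , eq ← q-shape = trans (cong (0# ^_) eq) (zeroˡ _)

    σ-neg : ∀ x → σ (- x) ≡ - σ x
    σ-neg x = begin
      σ (- x)                       ≡⟨ solve 2 (λ a b → a := a :+ b :+ :- b) refl (σ (- x)) (σ x) ⟩
      σ (- x) + σ x + - σ x         ≡⟨ cong (_+ - σ x) (trans (sym (σ-+ (- x) x)) (trans (cong σ (-‿inverseˡ x)) σ-0)) ⟩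
      0# + - σ x                    ≡⟨ +-identityˡ _ ⟩
      - σ x                         ∎

    σ-fixes-K : ∀ {x} → Member x → σ x ≡ x
    σ-fixes-K = fermat _≟_ K K-card

    σ-fixed⇒∈K : ∀ {x} → σ x ≡ x → Member x
    σ-fixed⇒∈K = fermat-converse _≟_ K K-card

    σ⁻¹ : Carrier → Carrier
    σ⁻¹ = iter (ℕ.pred d)

    σ∘σ⁻¹ : ∀ x → σ (σ⁻¹ x) ≡ x
    σ∘σ⁻¹ x = trans (cong (λ k → iter k x) (ℕ.suc-pred d)) (σᵈ≡id x)

    σ⁻¹∘σ : ∀ x → σ⁻¹ (σ x) ≡ x
    σ⁻¹∘σ x = trans (sym (iter-+ (ℕ.pred d) 1 x))
      (trans (cong (λ k → iter k x) (trans (ℕ.+-comm (ℕ.pred d) 1) (ℕ.suc-pred d))) (σᵈ≡id x))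

    σ-injective : ∀ {x y} → σ x ≡ σ y → x ≡ y
    σ-injective {x} {y} eq = trans (sym (σ⁻¹∘σ x)) (trans (cong σ⁻¹ eq) (σ⁻¹∘σ y))

    σ-isRingIsomorphism : IsRingIsomorphism σ
    σ-isRingIsomorphism = record
      { isRingMonomorphism = record
        { isRingHomomorphism = record
          { isSemiringHomomorphism = record
            { isNearSemiringHomomorphism = record
              { +-isMonoidHomomorphism = record
                { isMagmaHomomorphism = record { isRelHomomorphism = record { cong = cong σ } ; homo = σ-+ }
                ; ε-homo = σ-0 }
              ; *-homo = λ x y → ^-distrib-* x y q }
            ; 1#-homo = 1^ q }
          ; -‿homo = σ-neg }
        ; injective = σ-injective }
      ; surjective = λ y → σ⁻¹ y , λ where refl → σ∘σ⁻¹ y }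

    iter-∈Gal : ∀ k → Gal F K (iter k)
    iter-∈Gal zero    = Identity.isRingIsomorphism rawRing refl , λ _ → refl
    iter-∈Gal (suc k) with iter-∈Gal k
    ... | iso , fixes = Composition.isRingIsomorphism trans iso σ-isRingIsomorphism ,
                        λ x∈K → trans (cong σ (fixes x∈K)) (σ-fixes-K x∈K)

    iter-gcd-fixed : ∀ m {x} → iter m x ≡ x → iter (gcd d m) x ≡ x
    iter-gcd-fixed m fixed with Bézout.identity (gcd-GCD d m)
    ... | Bézout.+- a b eq = iter-difference-fixed (gcd d m) (b ℕ.* m) (iter-fixed b m fixed) (iter-fixed a d (σᵈ≡id _)) eq
    ... | Bézout.-+ a b eq = iter-difference-fixed (gcd d m) (a ℕ.* d) (iter-fixed a d (σᵈ≡id _)) (iter-fixed b m fixed) eq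

    iter-fixed-card : ∀ g → g ∣ d → HasCard (λ x → iter g x ≡ x) (q ℕ.^ g)
    iter-fixed-card zero    (divides t eq) = contradiction (trans eq (ℕ.*-zeroʳ t)) (ℕ.≢-nonZero⁻¹ d)
    iter-fixed-card (suc g) (divides zero eq) = contradiction eq (ℕ.≢-nonZero⁻¹ d)
    iter-fixed-card (suc g) (divides (suc t) eq) = card-≐ (trans (iter≡^ (suc g) _) , trans (sym (iter≡^ (suc g) _)))
      (subst (λ Q → HasCard (λ x → x ^ Q ≡ x) Q) (sym Q-eq)
        (frobenius-fixed-card k′ s (subst (HasCard U) n-eq F-card)))
      where
      -- `power-shape` is used twice: q^(g+1) = k′ + 2, and then n = (k′ + 2)^(t+1) = 1 + (s + 1)(k′
      -- + 1). The second equation is the divisibility of n - 1 by q^(g+1) - 1.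
      k = proj₁ q-shape
      k′ = k ℕ.+ proj₁ (power-shape k g) ℕ.* suc k
      s = proj₁ (power-shape k′ t)
      Q-eq : q ℕ.^ suc g ≡ suc (suc k′)
      Q-eq = trans (cong (ℕ._^ suc g) (proj₂ q-shape)) (proj₂ (power-shape k g))
      n-eq : q ℕ.^ d ≡ suc (suc s ℕ.* suc k′)
      n-eq = begin
        q ℕ.^ d                         ≡⟨ cong (q ℕ.^_) (trans eq (ℕ.*-comm (suc t) (suc g))) ⟩
        q ℕ.^ (suc g ℕ.* suc t)         ≡⟨ ℕ.^-*-assoc q (suc g) (suc t) ⟨
        (q ℕ.^ suc g) ℕ.^ suc t         ≡⟨ cong (ℕ._^ suc t) Q-eq ⟩
        suc (suc k′) ℕ.^ suc t          ≡⟨ proj₂ (power-shape k′ t) ⟩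
        suc (suc s ℕ.* suc k′)          ∎

    iter-gcd-fixed-card : ∀ m → HasCard (λ x → iter m x ≡ x) (q ℕ.^ gcd d m)
    iter-gcd-fixed-card m with gcd[m,n]∣n d m
    ... | divides t eq = card-≐
      ((λ fixed → trans (cong (λ k → iter k _) eq) (iter-fixed t (gcd d m) fixed)) , iter-gcd-fixed m)
      (iter-fixed-card (gcd d m) (gcd[m,n]∣m d m))

    module Element {φ : Carrier → Carrier} (φ∈Gal : Gal F K φ) = GaloisElement F K φ∈Gal

    map-addHead : ∀ {e} c (vs : Vec Carrier (suc e)) → map σ (addHead c vs) ≡ addHead (σ c) (map σ vs)
    map-addHead c (v ∷ vs) = cong (_∷ map σ vs) (σ-+ c v)

    map-mulLinear : ∀ {e} r (cs : Vec Carrier e) → map σ (mulLinear r cs) ≡ mulLinear (σ r) (map σ cs)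
    map-mulLinear r []       = cong (_∷ []) (σ-neg r)
    map-mulLinear r (c ∷ cs) = cong₂ _∷_ (trans (σ-neg (r * c)) (cong (-_) (^-distrib-* r c q)))
      (trans (map-addHead c (mulLinear r cs)) (cong (addHead (σ c)) (map-mulLinear r cs)))

    -- The product of X - a, X - σ a, ..., X - σ^(e-1) a, with repetitions if e exceeds the period
    -- of a.
    conjugatePoly : ∀ e → Carrier → Vec Carrier e
    conjugatePoly zero    a = []
    conjugatePoly (suc e) a = mulLinear a (conjugatePoly e (σ a))

    map-conjugatePoly : ∀ e a → map σ (conjugatePoly e a) ≡ conjugatePoly e (σ a)
    map-conjugatePoly zero    a = refl
    map-conjugatePoly (suc e) a = trans (map-mulLinear a _) (cong (mulLinear (σ a)) (map-conjugatePoly e (σ a)))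

    conjugatePoly-last : ∀ e a → mulLinear (iter e a) (conjugatePoly e a) ≡ conjugatePoly (suc e) a
    conjugatePoly-last zero    a = refl
    conjugatePoly-last (suc e) a = begin
      mulLinear (iter (suc e) a) (mulLinear a (conjugatePoly e (σ a)))  ≡⟨ mulLinear-comm _ a _ ⟩
      mulLinear a (mulLinear (iter (suc e) a) (conjugatePoly e (σ a)))  ≡⟨ cong (λ r → mulLinear a (mulLinear r (conjugatePoly e (σ a)))) (iter-suc e a) ⟩
      mulLinear a (mulLinear (iter e (σ a)) (conjugatePoly e (σ a)))    ≡⟨ cong (mulLinear a) (conjugatePoly-last e (σ a)) ⟩
      mulLinear a (conjugatePoly (suc e) (σ a))                         ∎

    -- Passing from a to σ a drops the factor X - a and gains X - σ^(e+1) a, which is the same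
    -- factor when e + 1 is a period. Together with `map-conjugatePoly` this makes the coefficients
    -- fixed by σ.
    conjugatePoly-rotate : ∀ e {a} → iter (suc e) a ≡ a → conjugatePoly (suc e) (σ a) ≡ conjugatePoly (suc e) a
    conjugatePoly-rotate e {a} period = begin
      conjugatePoly (suc e) (σ a)                               ≡⟨ conjugatePoly-last e (σ a) ⟨
      mulLinear (iter e (σ a)) (conjugatePoly e (σ a))          ≡⟨ cong (λ r → mulLinear r (conjugatePoly e (σ a))) (trans (sym (iter-suc e a)) period) ⟩
      conjugatePoly (suc e) a                                   ∎

    map-fixed⇒over-K : ∀ {e} (cs : Vec Carrier e) → map σ cs ≡ cs → All Member cs
    map-fixed⇒over-K []       _  = []
    map-fixed⇒over-K (c ∷ cs) eq = σ-fixed⇒∈K (∷-injectiveˡ eq) ∷ map-fixed⇒over-K cs (∷-injectiveʳ eq)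

    conjugatePoly-root : ∀ e a → evalMonic F (conjugatePoly (suc e) a) a ≡ 0#
    conjugatePoly-root e a = trans (evalMonic-mulLinear a (conjugatePoly e (σ a)) a) (trans (cong (_* evalMonic F (conjugatePoly e (σ a)) a) (-‿inverseʳ a)) (zeroˡ _))

    conjugatePoly-roots : ∀ e a {x} → evalMonic F (conjugatePoly e a) x ≡ 0# → a ∼ x
    conjugatePoly-roots zero    a     eq = contradiction (sym eq) 0≢1
    conjugatePoly-roots (suc e) a {x} eq = decide (x ≟ a)
      where
      decide : Dec (x ≡ a) → a ∼ x
      decide (yes x≡a) = 0 , sym x≡a
      decide (no  x≢a) =
        let k , eq′ = conjugatePoly-roots e (σ a) (*-zero-product (x≢a ∘ x-y≡0⇒x≡y)
                        (trans (sym (evalMonic-mulLinear a (conjugatePoly e (σ a)) x)) eq))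
        in suc k , trans (iter-suc k a) eq′

    private
      orbit-period : ∀ a → ∃ λ e → iter (suc e) a ≡ a × (∀ {k} → k < e → iter (suc k) a ≢ a)
      -- The search descends from the known period d, that is, from k = d - 1. Counting periods as k
      -- + 1 excludes the exponent 0.
      orbit-period a = least (λ k → iter (suc k) a ≟ a) {ℕ.pred d}
        (trans (cong (λ k → iter k a) (ℕ.suc-pred d)) (σᵈ≡id a))

    conjugates-card : ∀ a → HasCard (a ∼_) (suc (proj₁ (orbit-period a)))
    conjugates-card a = let e , period , minimal = orbit-period a in orbit-card σ-injective period minimal

    minimalPolynomial : ∀ a → MinimalPolynomial F K a
    minimalPolynomial a = let e , period , _ = orbit-period a in record
      { degree  = suc e
      ; coeffs  = conjugatePoly (suc e) a
      ; over-K  = map-fixed⇒over-K _ (trans (map-conjugatePoly (suc e) a) (conjugatePoly-rotate e period))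
      ; root    = conjugatePoly-root e a
      -- A polynomial over `K` that vanishes at a vanishes at all its conjugates, of which there are
      -- e + 1; the root bound then gives the degree.
      ; minimal = λ cs cs∈K root → root-card-bound cs (conjugates-card a) λ where
          (k , refl) → trans (sym (Element.evalMonic-homo (iter-∈Gal k) cs cs∈K a))
                             (trans (cong (iter k) root) (Element.0#-homo (iter-∈Gal k)))
      }

    Gal⇒∼ : ∀ {φ} → Gal F K φ → ∀ a → a ∼ φ a
    Gal⇒∼ {φ} φ∈Gal a = conjugatePoly-roots degree a
      (trans (sym (evalMonic-homo coeffs over-K a)) (trans (cong φ root) 0#-homo))
      where
      open MinimalPolynomial (minimalPolynomial a)
      open Element φ∈Gal

-- Affine frames in the plane and the orbits of triples under ASL

module Plane where

  open Counting
  open import Defs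
  open Fields using (module FieldProperties)
  open Frobenius using (module GaloisElement)
  import Algebra.Morphism.Construct.Identity as Identity
  open import Data.Fin using () renaming (zero to fzero; suc to fsuc)
  open import Data.Nat as ℕ using (ℕ)
  open import Data.Product using (∃; ∃₂; _×_; _,_; proj₁)
  open import Data.Sum using (_⊎_; inj₁; inj₂)
  open import Data.Unit using (tt)
  open import Data.Vec using (Vec; []; _∷_; lookup)
  open import Data.Vec.Properties using (∷-injectiveˡ; map-cong; map-id)
  open import Function using (_∘_; id)
  open import Level using (0ℓ)
  open import Relation.Binary.Definitions using (DecidableEquality)
  open import Relation.Binary.PropositionalEquality
  open import Relation.Nullary using (¬_; yes; no; contradiction)
  open import Relation.Unary using (Pred; U; _≐_)

  open ≡-Reasoning

  module AffinePlane (F : Field) (_≟_ : DecidableEquality (Field.Carrier F)) (K : Subfield F) where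
    open Field F
    open FieldProperties F

    H = Gal F K

    pair : Carrier → Carrier → V F 2
    pair a b = a ∷ b ∷ []

    -- The point with coordinates (a, b) in the affine frame with origin x and axes u, w. The axes
    -- are the columns of the linear part, while `Matrix` stores rows: columns are the images of the
    -- basis vectors, and these are what a triple in an orbit reveals.
    point : (u w x : V F 2) → Carrier → Carrier → V F 2
    point (u₁ ∷ u₂ ∷ []) (w₁ ∷ w₂ ∷ []) (x₁ ∷ x₂ ∷ []) a b =
      pair (x₁ + (a * u₁ + b * w₁)) (x₂ + (a * u₂ + b * w₂))

    affine : (Carrier → Carrier) → (u w x : V F 2) → V F 2 → V F 2
    affine φ u w x (a ∷ b ∷ []) = point u w x (φ a) (φ b)

    infixl 6 _-ᵛ_
    _-ᵛ_ : V F 2 → V F 2 → V F 2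
    (y₁ ∷ y₂ ∷ []) -ᵛ (x₁ ∷ x₂ ∷ []) = pair (y₁ + - x₁) (y₂ + - x₂)

    area : V F 2 → V F 2 → Carrier
    area (u₁ ∷ u₂ ∷ []) (w₁ ∷ w₂ ∷ []) = u₁ * w₂ + - (u₂ * w₁)

    origin e₁ e₂ : V F 2
    origin = pair 0# 0#
    e₁ = pair 1# 0#
    e₂ = pair 0# 1#

    ASL⇒affine : ∀ {g} → ASL F H 2 g → ∃ λ φ → H φ × ∃ λ u → ∃₂ λ w x → area u w ≡ 1# × (∀ v → g v ≡ affine φ u w x v)
    ASL⇒affine {g} (((p ∷ q ∷ []) ∷ (r ∷ s ∷ []) ∷ []) , φ , (b₁ ∷ b₂ ∷ []) , det≡1 , φ∈H , eq) =
      φ , φ∈H , pair p r , pair q s , pair b₁ b₂ ,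
      -- The right-hand side of the identity is `det` as it unfolds on a 2 by 2 matrix.
      trans (solve 4 (λ p q r s → p :* s :+ :- (r :* q) := p :* (s :* :1 :+ :- :0) :+ :- (q :* (r :* :1 :+ :- :0) :+ :- :0))
        refl p q r s) det≡1 ,
      λ where (a ∷ b ∷ []) → trans (eq (a ∷ b ∷ [])) (cong₂ pair (entry p q b₁ a b) (entry r s b₂ a b))
      where
      entry : ∀ p q b₁ a b → p * φ a + (q * φ b + 0#) + b₁ ≡ b₁ + (φ a * p + φ b * q)
      entry p q b₁ a b = solve 5 (λ p q b₁ a b → p :* a :+ (q :* b :+ :0) :+ b₁ := b₁ :+ (a :* p :+ b :* q)) refl p q b₁ (φ a) (φ b)

    affine∈ASL : ∀ {φ u w x} → H φ → area u w ≡ 1# → ASL F H 2 (affine φ u w x)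
    affine∈ASL {φ} {p ∷ r ∷ []} {q ∷ s ∷ []} {b₁ ∷ b₂ ∷ []} φ∈H area≡1 =
      (pair p q ∷ pair r s ∷ []) , φ , pair b₁ b₂ ,
      trans (solve 4 (λ p q r s → p :* (s :* :1 :+ :- :0) :+ :- (q :* (r :* :1 :+ :- :0) :+ :- :0) := p :* s :+ :- (r :* q))
        refl p q r s) area≡1 ,
      φ∈H ,
      λ where (a ∷ b ∷ []) → cong₂ pair (entry p q b₁ a b) (entry r s b₂ a b)
      where
      entry : ∀ p q b₁ a b → b₁ + (φ a * p + φ b * q) ≡ p * φ a + (q * φ b + 0#) + b₁
      entry p q b₁ a b = solve 5 (λ p q b₁ a b → b₁ :+ (a :* p :+ b :* q) := p :* a :+ (q :* b :+ :0) :+ b₁) refl p q b₁ (φ a) (φ b)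

    id∈Gal : H id
    id∈Gal = Identity.isRingIsomorphism rawRing refl , λ _ → refl

    point-frame : ∀ v → point e₁ e₂ origin (lookup v fzero) (lookup v (fsuc fzero)) ≡ v
    point-frame (a ∷ b ∷ []) = cong₂ pair
      (solve 2 (λ a b → :0 :+ (a :* :1 :+ b :* :0) := a) refl a b)
      (solve 2 (λ a b → :0 :+ (a :* :0 :+ b :* :1) := b) refl a b)

    area-frame : area e₁ e₂ ≡ 1#
    area-frame = solve 0 (:1 :* :1 :+ :- (:0 :* :0) := :1) refl

    orbit-refl : ∀ t → Orbit (ASL F H 2) t t
    orbit-refl t = affine id e₁ e₂ origin , affine∈ASL id∈Gal area-frame , sym (trans (map-cong fixes t) (map-id t))
      where
      fixes : ∀ v → affine id e₁ e₂ origin v ≡ v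
      fixes v@(_ ∷ _ ∷ []) = point-frame v

    point-0-0 : ∀ u w x → point u w x 0# 0# ≡ x
    point-0-0 (u₁ ∷ u₂ ∷ []) (w₁ ∷ w₂ ∷ []) (x₁ ∷ x₂ ∷ []) = cong₂ pair (entry x₁ u₁ w₁) (entry x₂ u₂ w₂)
      where
      entry : ∀ x u w → x + (0# * u + 0# * w) ≡ x
      entry = solve 3 (λ x u w → x :+ (:0 :* u :+ :0 :* w) := x) refl

    point-1-0-displacement : ∀ u w x → point u w x 1# 0# -ᵛ x ≡ u
    point-1-0-displacement (u₁ ∷ u₂ ∷ []) (w₁ ∷ w₂ ∷ []) (x₁ ∷ x₂ ∷ []) = cong₂ pair (entry x₁ u₁ w₁) (entry x₂ u₂ w₂)
      where
      entry : ∀ x u w → x + (1# * u + 0# * w) + - x ≡ u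
      entry = solve 3 (λ x u w → x :+ (:1 :* u :+ :0 :* w) :+ :- x := u) refl

    point-1-0 : ∀ x y w → point (y -ᵛ x) w x 1# 0# ≡ y
    point-1-0 (x₁ ∷ x₂ ∷ []) (y₁ ∷ y₂ ∷ []) (w₁ ∷ w₂ ∷ []) = cong₂ pair (entry x₁ y₁ w₁) (entry x₂ y₂ w₂)
      where
      entry : ∀ x y w → x + (1# * (y + - x) + 0# * w) ≡ y
      entry = solve 3 (λ x y w → x :+ (:1 :* (y :+ :- x) :+ :0 :* w) := y) refl

    -- On the first axis the choice of the second one does not matter, so R^a can be described by
    -- any frame that completes y - x.
    point-axis : ∀ u w w′ x c → point u w x c 0# ≡ point u w′ x c 0#
    point-axis (u₁ ∷ u₂ ∷ []) (w₁ ∷ w₂ ∷ []) (w₁′ ∷ w₂′ ∷ []) (x₁ ∷ x₂ ∷ []) c =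
      cong₂ pair (cong (λ y → x₁ + (c * u₁ + y)) (trans (zeroˡ w₁) (sym (zeroˡ w₁′))))
                 (cong (λ y → x₂ + (c * u₂ + y)) (trans (zeroˡ w₂) (sym (zeroˡ w₂′))))

    module _ (u w : V F 2) (area≡1 : area u w ≡ 1#) where

      -- Cramer's rule in a frame of determinant one: the area with u reads off the second
      -- coordinate and, below, the area with w the first.
      second-coordinate : ∀ x a b → area u (point u w x a b -ᵛ x) ≡ b
      second-coordinate x a b = trans (expand u w x) (trans (cong (b *_) area≡1) (*-identityʳ b))
        where
        expand : ∀ u w x → area u (point u w x a b -ᵛ x) ≡ b * area u w
        expand (u₁ ∷ u₂ ∷ []) (w₁ ∷ w₂ ∷ []) (x₁ ∷ x₂ ∷ []) = solve 8
          (λ u₁ u₂ w₁ w₂ x₁ x₂ a b → u₁ :* (x₂ :+ (a :* u₂ :+ b :* w₂) :+ :- x₂) :+ :- (u₂ :* (x₁ :+ (a :* u₁ :+ b :* w₁) :+ :- x₁)) :=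
            b :* (u₁ :* w₂ :+ :- (u₂ :* w₁))) refl u₁ u₂ w₁ w₂ x₁ x₂ a b

      first-coordinate : ∀ x a b → area (point u w x a b -ᵛ x) w ≡ a
      first-coordinate x a b = trans (expand u w x) (trans (cong (a *_) area≡1) (*-identityʳ a))
        where
        expand : ∀ u w x → area (point u w x a b -ᵛ x) w ≡ a * area u w
        expand (u₁ ∷ u₂ ∷ []) (w₁ ∷ w₂ ∷ []) (x₁ ∷ x₂ ∷ []) = solve 8
          (λ u₁ u₂ w₁ w₂ x₁ x₂ a b → (x₁ :+ (a :* u₁ :+ b :* w₁) :+ :- x₁) :* w₂ :+ :- ((x₂ :+ (a :* u₂ :+ b :* w₂) :+ :- x₂) :* w₁) :=
            a :* (u₁ :* w₂ :+ :- (u₂ :* w₁))) refl u₁ u₂ w₁ w₂ x₁ x₂ a b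

      point-injective : ∀ x {a b a′ b′} → point u w x a b ≡ point u w x a′ b′ → a ≡ a′ × b ≡ b′
      point-injective x {a} {b} {a′} {b′} eq =
        trans (sym (first-coordinate x a b)) (trans (cong (λ z → area (z -ᵛ x) w) eq) (first-coordinate x a′ b′)) ,
        trans (sym (second-coordinate x a b)) (trans (cong (λ z → area u (z -ᵛ x)) eq) (second-coordinate x a′ b′))

      cramer : ∀ x z → point u w x (area (z -ᵛ x) w) (area u (z -ᵛ x)) ≡ z
      cramer x z = expand u w x z area≡1
        where
        expand : ∀ u w x z → area u w ≡ 1# → point u w x (area (z -ᵛ x) w) (area u (z -ᵛ x)) ≡ z
        expand (u₁ ∷ u₂ ∷ []) (w₁ ∷ w₂ ∷ []) (x₁ ∷ x₂ ∷ []) (z₁ ∷ z₂ ∷ []) eq = cong₂ pair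
          (trans (solve 8 (λ u₁ u₂ w₁ w₂ x₁ x₂ z₁ z₂ →
              x₁ :+ (((z₁ :+ :- x₁) :* w₂ :+ :- ((z₂ :+ :- x₂) :* w₁)) :* u₁ :+ (u₁ :* (z₂ :+ :- x₂) :+ :- (u₂ :* (z₁ :+ :- x₁))) :* w₁) :=
              x₁ :+ (z₁ :+ :- x₁) :* (u₁ :* w₂ :+ :- (u₂ :* w₁))) refl u₁ u₂ w₁ w₂ x₁ x₂ z₁ z₂) (collapse x₁ z₁ eq))
          (trans (solve 8 (λ u₁ u₂ w₁ w₂ x₁ x₂ z₁ z₂ →
              x₂ :+ (((z₁ :+ :- x₁) :* w₂ :+ :- ((z₂ :+ :- x₂) :* w₁)) :* u₂ :+ (u₁ :* (z₂ :+ :- x₂) :+ :- (u₂ :* (z₁ :+ :- x₁))) :* w₂) :=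
              x₂ :+ (z₂ :+ :- x₂) :* (u₁ :* w₂ :+ :- (u₂ :* w₁))) refl u₁ u₂ w₁ w₂ x₁ x₂ z₁ z₂) (collapse x₂ z₂ eq))
          where
          collapse : ∀ x z {D} → D ≡ 1# → x + (z + - x) * D ≡ z
          collapse x z refl = solve 2 (λ x z → x :+ (z :+ :- x) :* :1 := z) refl x z

    -- Some coordinate of y - x is nonzero, and its inverse, up to sign, is the only nonzero entry
    -- of w. This amounts to the two-transitivity of the group: the frame maps (0⃗ , 1⃗) to (x , y).
    complete-frame : ∀ {x y} → x ≢ y → ∃ λ w → area (y -ᵛ x) w ≡ 1#
    complete-frame {x₁ ∷ x₂ ∷ []} {y₁ ∷ y₂ ∷ []} x≢y with (y₁ + - x₁) ≟ 0# | (y₂ + - x₂) ≟ 0#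
    ... | no u₁≢0 | _ with v , eq ← inverse _ u₁≢0 = pair 0# v ,
      trans (solve 3 (λ u₁ u₂ v → u₁ :* v :+ :- (u₂ :* :0) := u₁ :* v) refl _ _ v) eq
    complete-frame {x₁ ∷ x₂ ∷ []} {y₁ ∷ y₂ ∷ []} x≢y | yes _ | no u₂≢0 with v , eq ← inverse _ u₂≢0 = pair (- v) 0# ,
      trans (solve 3 (λ u₁ u₂ v → u₁ :* :0 :+ :- (u₂ :* :- v) := u₂ :* v) refl _ _ v) eq
    complete-frame x≢y | yes u₁≡0 | yes u₂≡0 =
      contradiction (sym (cong₂ pair (x-y≡0⇒x≡y u₁≡0) (x-y≡0⇒x≡y u₂≡0))) x≢y

    Conjugate : Carrier → Pred Carrier 0ℓ
    Conjugate a c = ∃ λ φ → H φ × c ≡ φ a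

    conjugate-refl : ∀ a → Conjugate a a
    conjugate-refl a = id , id∈Gal , refl

    conjugate-nonzero : ∀ {a c} → a ≢ 0# → Conjugate a c → c ≢ 0#
    conjugate-nonzero a≢0 (φ , φ∈H , refl) φa≡0 = a≢0 (injective (trans φa≡0 (sym 0#-homo)))
      where open GaloisElement F K φ∈H

    -- As φ fixes 0 and 1, the images of the origin and of `e₁` determine the translation and the
    -- first column. Only φ and the second column w stay free.
    ASL-frame : ∀ {g} → ASL F H 2 g → ∃ λ φ → H φ × ∃ λ w → area (g e₁ -ᵛ g origin) w ≡ 1# ×
                (∀ a b → g (pair a b) ≡ point (g e₁ -ᵛ g origin) w (g origin) (φ a) (φ b))
    ASL-frame {g} g∈ with φ , φ∈H , u , w , x , area≡1 , eq ← ASL⇒affine g∈ =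
      φ , φ∈H , w , subst (λ u → area u w ≡ 1#) (sym displacement≡u) area≡1 ,
      λ a b → trans (eq (pair a b)) (cong₂ (λ u x → point u w x (φ a) (φ b)) (sym displacement≡u) (sym g-origin))
      where
      open GaloisElement F K φ∈H
      g-origin : g origin ≡ x
      g-origin = trans (eq origin) (trans (cong₂ (point u w x) 0#-homo 0#-homo) (point-0-0 u w x))
      displacement≡u : g e₁ -ᵛ g origin ≡ u
      displacement≡u = trans
        (cong₂ _-ᵛ_ (trans (eq e₁) (cong₂ (point u w x) 1#-homo 0#-homo)) g-origin)
        (point-1-0-displacement u w x)

    upperR⇒ : ∀ {a x y z} w → upperR F H a ⟨ x , y , z ⟩ →
              ∃ λ c → Conjugate a c × z ≡ point (y -ᵛ x) w x c 0#
    upperR⇒ {a} w (g , g∈ , refl) with φ , φ∈H , w′ , _ , eq ← ASL-frame g∈ =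
      φ a , (φ , φ∈H , refl) , trans (eq a 0#)
        (trans (cong (point _ w′ _ (φ a)) (GaloisElement.0#-homo F K φ∈H)) (point-axis _ w′ w _ (φ a)))

    -- The area is the second coordinate φ(a) of z in the frame provided by g. The converse `leftR⇐`
    -- assumes a ≠ 0, because for a = 0 the orbit contains only triples with z = x.
    leftR⇒ : ∀ {a x y z} → leftR F H a ⟨ x , y , z ⟩ → Conjugate a (area (y -ᵛ x) (z -ᵛ x))
    leftR⇒ {a} (g , g∈ , refl) with φ , φ∈H , w , area≡1 , eq ← ASL-frame g∈ =
      φ , φ∈H , trans (cong (λ z → area (g e₁ -ᵛ g origin) (z -ᵛ g origin)) (eq 0# a)) (second-coordinate (g e₁ -ᵛ g origin) w area≡1 (g origin) (φ 0#) (φ a))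

    affine-orbit : ∀ {φ x y w} a b → H φ → area (y -ᵛ x) w ≡ 1# →
                   Orbit (ASL F H 2) ⟨ origin , e₁ , pair a b ⟩ ⟨ x , y , point (y -ᵛ x) w x (φ a) (φ b) ⟩
    affine-orbit {φ} {x} {y} {w} a b φ∈H area≡1 = affine φ (y -ᵛ x) w x , affine∈ASL φ∈H area≡1 ,
      cong₂ (λ x′ y′ → ⟨ x′ , y′ , point (y -ᵛ x) w x (φ a) (φ b) ⟩)
        (sym (trans (cong₂ (point (y -ᵛ x) w x) 0#-homo 0#-homo) (point-0-0 _ w x)))
        (sym (trans (cong₂ (point (y -ᵛ x) w x) 1#-homo 0#-homo) (point-1-0 x y w)))
      where open GaloisElement F K φ∈H

    upperR⇐ : ∀ {a c x y w} → area (y -ᵛ x) w ≡ 1# → Conjugate a c →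
              upperR F H a ⟨ x , y , point (y -ᵛ x) w x c 0# ⟩
    upperR⇐ {a} {x = x} {y} {w} area≡1 (φ , φ∈H , refl) =
      subst (λ b → upperR F H a ⟨ x , y , point (y -ᵛ x) w x (φ a) b ⟩) (GaloisElement.0#-homo F K φ∈H)
        (affine-orbit a 0# φ∈H area≡1)

    -- The second axis of the frame is (z - x) / area (y - x) (z - x).
    leftR⇐ : ∀ {a x y z} → a ≢ 0# → Conjugate a (area (y -ᵛ x) (z -ᵛ x)) → leftR F H a ⟨ x , y , z ⟩
    leftR⇐ {a} {x} {y} {z} a≢0 conj@(φ , φ∈H , eq) with v , inv ← inverse _ (conjugate-nonzero a≢0 conj) =
      subst (λ z → leftR F H a ⟨ x , y , z ⟩)
        (trans (cong₂ (point (y -ᵛ x) w x) (GaloisElement.0#-homo F K φ∈H) (sym eq)) (reach (y -ᵛ x) x z v inv))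
        (affine-orbit 0# a φ∈H (trans (area-scale v (y -ᵛ x) (z -ᵛ x)) inv))
      where
      scale : Carrier → V F 2 → V F 2
      scale c (u₁ ∷ u₂ ∷ []) = pair (c * u₁) (c * u₂)
      w = scale v (z -ᵛ x)
      area-scale : ∀ c u w → area u (scale c w) ≡ area u w * c
      area-scale c (u₁ ∷ u₂ ∷ []) (w₁ ∷ w₂ ∷ []) =
        solve 5 (λ c u₁ u₂ w₁ w₂ → u₁ :* (c :* w₂) :+ :- (u₂ :* (c :* w₁)) := (u₁ :* w₂ :+ :- (u₂ :* w₁)) :* c) refl c u₁ u₂ w₁ w₂
      reach : ∀ u x z v {D} → D * v ≡ 1# → point u (scale v (z -ᵛ x)) x 0# D ≡ z
      reach (u₁ ∷ u₂ ∷ []) (x₁ ∷ x₂ ∷ []) (z₁ ∷ z₂ ∷ []) v {D} Dv≡1 = cong₂ pair (entry u₁ x₁ z₁) (entry u₂ x₂ z₂)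
        where
        entry : ∀ u x z → x + (0# * u + D * (v * (z + - x))) ≡ z
        entry u x z = trans
          (solve 5 (λ u x z v D → x :+ (:0 :* u :+ D :* (v :* (z :+ :- x))) := x :+ D :* v :* (z :+ :- x)) refl u x z v D)
          (trans (cong (λ y → x + y * (z + - x)) Dv≡1) (solve 2 (λ x z → x :+ :1 :* (z :+ :- x) := z) refl x z))

    upperBase leftBase : Carrier → Triple (V F 2)
    upperBase a = ⟨ origin , e₁ , pair a 0# ⟩
    leftBase  a = ⟨ origin , e₁ , pair 0# a ⟩

    private
      e₁-displacement : e₁ -ᵛ origin ≡ e₁
      e₁-displacement = cong₂ pair (solve 0 (:1 :+ :- :0 := :1) refl) (solve 0 (:0 :+ :- :0 := :0) refl)

      area-e₁ : ∀ v → area (e₁ -ᵛ origin) (v -ᵛ origin) ≡ lookup v (fsuc fzero)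
      area-e₁ (a ∷ b ∷ []) = solve 2 (λ a b → (:1 :+ :- :0) :* (b :+ :- :0) :+ :- ((:0 :+ :- :0) :* (a :+ :- :0)) := b) refl a b

      frame-e₁ : area (e₁ -ᵛ origin) e₂ ≡ 1#
      frame-e₁ = trans (cong (λ u → area u e₂) e₁-displacement) area-frame

      point-e₁ : ∀ c → point (e₁ -ᵛ origin) e₂ origin c 0# ≡ pair c 0#
      point-e₁ c = trans (cong (λ u → point u e₂ origin c 0#) e₁-displacement) (point-frame (pair c 0#))

    upperBase⇒ : ∀ {a b} → upperR F H a (upperBase b) → Conjugate a b
    upperBase⇒ b∈ with c , conj , eq ← upperR⇒ e₂ b∈ =
      subst (Conjugate _) (sym (∷-injectiveˡ (trans eq (point-e₁ c)))) conj

    upperBase⇐ : ∀ {a b} → Conjugate a b → upperR F H a (upperBase b)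
    upperBase⇐ {a} {b} conj = subst (λ z → upperR F H a ⟨ origin , e₁ , z ⟩) (point-e₁ b) (upperR⇐ frame-e₁ conj)

    leftBase⇒ : ∀ {a b} → leftR F H a (leftBase b) → Conjugate a b
    leftBase⇒ b∈ = subst (Conjugate _) (area-e₁ _) (leftR⇒ b∈)

    leftBase⇐ : ∀ {a b} → a ≢ 0# → Conjugate a b → leftR F H a (leftBase b)
    leftBase⇐ a≢0 conj = leftR⇐ a≢0 (subst (Conjugate _) (sym (area-e₁ _)) conj)

    -- The entries of a triple in the first family are collinear, those in the second are not: an
    -- area 0 would have to be conjugate to b.
    upper-left-disjoint : ∀ {a b} → b ≢ 0# → ¬ leftR F H b (upperBase a)
    upper-left-disjoint b≢0 a∈ = conjugate-nonzero b≢0 (leftR⇒ a∈) (area-e₁ _)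

    upper-third-valency : ∀ {a k} → HasCard (Conjugate a) k → HasThirdValency (upperR F H a) k
    upper-third-valency conj-card {x} {y} x≢y with w , area≡1 ← complete-frame x≢y = card-≐
      ((λ where (c , conj , refl) → upperR⇐ area≡1 conj) , upperR⇒ w)
      (card-image (λ c → point (y -ᵛ x) w x c 0#) (λ _ _ → proj₁ ∘ point-injective (y -ᵛ x) w area≡1 x) conj-card)

    -- In a frame completing y - x only the second coordinate of z is constrained, to the conjugates
    -- of a. The free first coordinate contributes the factor n.
    left-third-valency : ∀ {a n k} → a ≢ 0# → HasCard {Carrier} U n → HasCard (Conjugate a) k →
                         HasThirdValency (leftR F H a) (n ℕ.* k)
    left-third-valency a≢0 F-card conj-card {x} {y} x≢y with w , area≡1 ← complete-frame x≢y = card-≐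
      ( (λ where (b , c , _ , conj , refl) → leftR⇐ a≢0 (subst (Conjugate _) (sym (second-coordinate (y -ᵛ x) w area≡1 x b c)) conj))
      , (λ {z} z∈ → area (z -ᵛ x) w , area (y -ᵛ x) (z -ᵛ x) , tt , leftR⇒ z∈ , sym (cramer (y -ᵛ x) w area≡1 x z)))
      (card-cartesian (point (y -ᵛ x) w x) (point-injective (y -ᵛ x) w area≡1 x) F-card conj-card)

    -- A nonzero area of y - x and z - x serves itself as the parameter of the second family. If the
    -- area is zero, z lies on the line through x and y, and its coordinate there is neither 0 nor 1
    -- because z differs from both points.
    classify : ∀ {x y z} → x ≢ y → x ≢ z → y ≢ z →
               (∃ λ a → a ≢ 0# × leftR F H a ⟨ x , y , z ⟩) ⊎
               (∃ λ a → a ≢ 0# × a ≢ 1# × upperR F H a ⟨ x , y , z ⟩)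
    classify {x} {y} {z} x≢y x≢z y≢z with w , area≡1 ← complete-frame x≢y | area (y -ᵛ x) (z -ᵛ x) ≟ 0#
    ... | no  c≢0 = inj₁ (_ , c≢0 , leftR⇐ c≢0 (conjugate-refl _))
    ... | yes c≡0 = inj₂ (a , a≢0 , a≢1 , subst (λ z → upperR F H a ⟨ x , y , z ⟩) a-point (upperR⇐ area≡1 (conjugate-refl a)))
      where
      a = area (z -ᵛ x) w
      a-point : point (y -ᵛ x) w x a 0# ≡ z
      a-point = trans (cong (point (y -ᵛ x) w x a) (sym c≡0)) (cramer (y -ᵛ x) w area≡1 x z)
      a≢0 : a ≢ 0#
      a≢0 a≡0 = x≢z (trans (sym (point-0-0 (y -ᵛ x) w x)) (trans (cong (λ a → point (y -ᵛ x) w x a 0#) (sym a≡0)) a-point))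
      a≢1 : a ≢ 1#
      a≢1 a≡1 = y≢z (trans (sym (point-1-0 x y w)) (trans (cong (λ a → point (y -ᵛ x) w x a 0#) (sym a≡1)) a-point))

-- Nontrivial relations of the scheme and their indexing by conjugacy classes

module Scheme where

  open Counting
  open import Defs
  open Frobenius using (module GaloisElement)
  open Plane using (module AffinePlane)
  open import Data.Fin using (Fin; fromℕ<; toℕ)
  open import Data.Fin.Properties using (toℕ-fromℕ<)
  open import Data.Nat as ℕ using (ℕ; suc; _≤_; _<_; z≤n; s≤s)
  import Data.Nat.Properties as ℕ
  open import Data.Product using (∃; _×_; _,_; proj₁; proj₂)
  open import Data.Sum as Sum using (_⊎_; inj₁; inj₂; fromInj₂)
  open import Data.Vec using (_∷_)
  open import Data.Vec.Properties using (≡-dec; ∷-injectiveˡ; ∷-injectiveʳ)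
  open import Function using (_∘_)
  open import Level using (0ℓ)
  open import Relation.Binary.Definitions using (DecidableEquality)
  open import Relation.Binary.PropositionalEquality
  open import Relation.Nullary using (¬_; yes; no; contradiction)
  open import Relation.Unary using (Pred; _≐_; _∩_; _∪_)

  module NontrivialRelations {Ω : Set} (_≟_ : DecidableEquality Ω) (X : AST Ω) where
    open AST X

    private
      trivialIndex : ∀ {k} → k < 4 → ∃ λ i → toℕ i ≡ k
      trivialIndex k<4 = fromℕ< (ℕ.≤-trans k<4 (ℕ.m≤n⇒m≤1+n m≥4)) , toℕ-fromℕ< _

      not-trivial : ∀ {i j t k} → k < 4 → 4 ≤ toℕ i → toℕ j ≡ k → R i t → ¬ R j t
      not-trivial k<4 nontrivial refl ti tj = ℕ.<⇒≱ k<4 (subst (λ i → 4 ≤ toℕ i) (disjoint ti tj) nontrivial)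

    nontrivial⇒distinct : ∀ {i x y z} → Nontrivial i → R i ⟨ x , y , z ⟩ → x ≢ y × x ≢ z × y ≢ z
    nontrivial⇒distinct {i} {x} {y} {z} nontrivial t∈ = x≢y , x≢z , y≢z
      where
      -- The case y = z comes first, as it alone has to distinguish two trivial relations, the
      -- diagonal and R₁. Each later case takes an inequality already proved as the evidence for R₂
      -- or R₃.
      y≢z : y ≢ z
      y≢z refl with x ≟ y | trivialIndex {0} (s≤s z≤n) | trivialIndex {1} (s≤s (s≤s z≤n))
      ... | yes refl | j , j≡0 | _ = not-trivial (s≤s z≤n) nontrivial j≡0 t∈ (proj₂ (trivial₀ j j≡0) (x , refl))
      ... | no  x≢y  | _ | j , j≡1 = not-trivial (s≤s (s≤s z≤n)) nontrivial j≡1 t∈ (proj₂ (trivial₁ j j≡1) (x , y , x≢y , refl))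
      x≢z : x ≢ z
      x≢z refl with trivialIndex {2} (s≤s (s≤s (s≤s z≤n)))
      ... | j , j≡2 = not-trivial (s≤s (s≤s (s≤s z≤n))) nontrivial j≡2 t∈ (proj₂ (trivial₂ j j≡2) (y , x , y≢z , refl))
      x≢y : x ≢ y
      x≢y refl with trivialIndex {3} (s≤s (s≤s (s≤s (s≤s z≤n))))
      ... | j , j≡3 = not-trivial (s≤s (s≤s (s≤s (s≤s z≤n)))) nontrivial j≡3 t∈ (proj₂ (trivial₃ j j≡3) (z , x , x≢z ∘ sym , refl))

    distinct⇒nontrivial : ∀ {i x y z} → x ≢ y → x ≢ z → y ≢ z → R i ⟨ x , y , z ⟩ → Nontrivial i
    distinct⇒nontrivial {i} x≢y x≢z y≢z t∈ with toℕ i in eq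
    ... | 0 with _ , refl ← proj₁ (trivial₀ i eq) t∈         = contradiction refl x≢y
    ... | 1 with _ , _ , _ , refl ← proj₁ (trivial₁ i eq) t∈ = contradiction refl y≢z
    ... | 2 with _ , _ , _ , refl ← proj₁ (trivial₂ i eq) t∈ = contradiction refl x≢z
    ... | 3 with _ , _ , _ , refl ← proj₁ (trivial₃ i eq) t∈ = contradiction refl x≢y
    ... | suc (suc (suc (suc _))) = s≤s (s≤s (s≤s (s≤s z≤n)))

  module Relations (F : Field) (_≟_ : DecidableEquality (Field.Carrier F)) (K : Subfield F)
                   (X : AST (V F 2)) (obtained : X ObtainedFrom ASL F (Gal F K) 2) where
    open Field F
    open AST X
    open AffinePlane F _≟_ K
    open NontrivialRelations (≡-dec _≟_) X

    conjugate-one : ∀ {a} → Conjugate a 1# → a ≡ 1#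
    conjugate-one (φ , φ∈H , 1≡φa) = sym (injective (trans 1#-homo 1≡φa))
      where open GaloisElement F K φ∈H

    orbitIndex : Triple (V F 2) → Fin (suc m)
    orbitIndex t = proj₁ (proj₂ obtained t)

    R-orbitIndex : ∀ t → R (orbitIndex t) ≐ Orbit (ASL F H 2) t
    R-orbitIndex t = proj₂ (proj₂ obtained t)

    orbitIndex-unique : ∀ {i t s} → R i s → Orbit (ASL F H 2) t s → i ≡ orbitIndex t
    orbitIndex-unique s∈ s∈Orbit = disjoint s∈ (proj₂ (R-orbitIndex _) s∈Orbit)

    upper-distinct : ∀ {i a} → a ≢ 0# → a ≢ 1# → R i (upperBase a) → Nontrivial i
    upper-distinct a≢0 a≢1 = distinct⇒nontrivial (0≢1 ∘ ∷-injectiveˡ) (a≢0 ∘ sym ∘ ∷-injectiveˡ) (a≢1 ∘ sym ∘ ∷-injectiveˡ)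

    left-distinct : ∀ {i a} → a ≢ 0# → R i (leftBase a) → Nontrivial i
    left-distinct a≢0 = distinct⇒nontrivial (0≢1 ∘ ∷-injectiveˡ)
      (a≢0 ∘ sym ∘ ∷-injectiveˡ ∘ ∷-injectiveʳ) (0≢1 ∘ sym ∘ ∷-injectiveˡ)

    upper⊎left : ∀ {i} → Nontrivial i → IsUpper F H X i ⊎ IsLeft F H X i
    upper⊎left {i} nontrivial with nonempty i
    ... | t@(⟨ x , y , z ⟩) , t∈ with x≢y , x≢z , y≢z ← nontrivial⇒distinct nontrivial t∈ | classify x≢y x≢z y≢z
    ... | inj₁ (a , a≢0 , t∈Orbit) = inj₂ (nontrivial , a , a≢0 ,
      subst (λ i → R i ≐ leftR F H a) (sym (orbitIndex-unique t∈ t∈Orbit)) (R-orbitIndex (leftBase a)))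
    ... | inj₂ (a , a≢0 , a≢1 , t∈Orbit) = inj₁ (nontrivial , a , a≢0 , a≢1 ,
      subst (λ i → R i ≐ upperR F H a) (sym (orbitIndex-unique t∈ t∈Orbit)) (R-orbitIndex (upperBase a)))

    left⇒¬upper : ∀ {i} → IsLeft F H X i → ¬ IsUpper F H X i
    left⇒¬upper (_ , b , b≢0 , R≐left) (_ , a , _ , _ , R≐upper) =
      upper-left-disjoint b≢0 (proj₁ R≐left (proj₂ R≐upper (upperBase⇐ (conjugate-refl a))))

    remaining≐left : Remaining F H X ≐ IsLeft F H X
    remaining≐left =
      (λ (nontrivial , ¬upper) → fromInj₂ (λ upper → contradiction upper ¬upper) (upper⊎left nontrivial)) ,
      λ left → proj₁ left , left⇒¬upper left

    -- A transversal of the conjugacy classes. Conjugate parameters give the same relation, so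
    -- counting relations once each means counting representatives.
    module _ (IsRep : Pred Carrier 0ℓ) (rep : Carrier → Carrier) (rep-isRep : ∀ a → IsRep (rep a))
             (rep-conjugate : ∀ a → Conjugate a (rep a))
             (rep-unique : ∀ {a b} → IsRep a → IsRep b → Conjugate a b → a ≡ b) where

      -- Every φ in `H` fixes 0, so the representative of the class of 0 can only be 0 itself. The
      -- same holds for 1, so that excluding these two parameters removes exactly two
      -- representatives.
      0-isRep : IsRep 0#
      0-isRep with rep 0# | rep-isRep 0# | rep-conjugate 0#
      ... | _ | isRep | φ , φ∈H , refl = subst IsRep (GaloisElement.0#-homo F K φ∈H) isRep

      1-isRep : IsRep 1#
      1-isRep with rep 1# | rep-isRep 1# | rep-conjugate 1#
      ... | _ | isRep | φ , φ∈H , refl = subst IsRep (GaloisElement.1#-homo F K φ∈H) isRep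

      rep≢0 : ∀ {a} → a ≢ 0# → rep a ≢ 0#
      rep≢0 a≢0 = conjugate-nonzero a≢0 (rep-conjugate _)

      rep≢1 : ∀ {a} → a ≢ 1# → rep a ≢ 1#
      rep≢1 {a} a≢1 rep≡1 = a≢1 (conjugate-one (subst (Conjugate a) rep≡1 (rep-conjugate a)))

      upper-card : ∀ {k} → HasCard ((IsRep ∩ (_≢ 0#)) ∩ (_≢ 1#)) k → HasCard (IsUpper F H X) k
      upper-card reps = card-≐ (to , from) (card-image (orbitIndex ∘ upperBase) inj reps)
        where
        inj : ∀ {a b} → ((IsRep ∩ (_≢ 0#)) ∩ (_≢ 1#)) a → ((IsRep ∩ (_≢ 0#)) ∩ (_≢ 1#)) b →
              orbitIndex (upperBase a) ≡ orbitIndex (upperBase b) → a ≡ b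
        inj {a} {b} ((ra , _) , _) ((rb , _) , _) eq = rep-unique ra rb (upperBase⇒
          (proj₁ (R-orbitIndex (upperBase a)) (subst (λ i → R i (upperBase b)) (sym eq)
            (proj₂ (R-orbitIndex (upperBase b)) (orbit-refl (upperBase b))))))
        to : ∀ {i} → (∃ λ a → ((IsRep ∩ (_≢ 0#)) ∩ (_≢ 1#)) a × i ≡ orbitIndex (upperBase a)) → IsUpper F H X i
        to (a , ((_ , a≢0) , a≢1) , refl) =
          upper-distinct a≢0 a≢1 (proj₂ (R-orbitIndex (upperBase a)) (orbit-refl (upperBase a))) ,
          a , a≢0 , a≢1 , R-orbitIndex (upperBase a)
        from : ∀ {i} → IsUpper F H X i → ∃ λ a → ((IsRep ∩ (_≢ 0#)) ∩ (_≢ 1#)) a × i ≡ orbitIndex (upperBase a)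
        from (_ , a , a≢0 , a≢1 , R≐upper) = rep a , ((rep-isRep a , rep≢0 a≢0) , rep≢1 a≢1) ,
          orbitIndex-unique (proj₂ R≐upper (upperBase⇐ (rep-conjugate a))) (orbit-refl (upperBase (rep a)))

      left-card : ∀ {k} → HasCard (IsRep ∩ (_≢ 0#)) k → HasCard (IsLeft F H X) k
      left-card reps = card-≐ (to , from) (card-image (orbitIndex ∘ leftBase) inj reps)
        where
        inj : ∀ {a b} → (IsRep ∩ (_≢ 0#)) a → (IsRep ∩ (_≢ 0#)) b →
              orbitIndex (leftBase a) ≡ orbitIndex (leftBase b) → a ≡ b
        inj {a} {b} (ra , _) (rb , _) eq = rep-unique ra rb (leftBase⇒
          (proj₁ (R-orbitIndex (leftBase a)) (subst (λ i → R i (leftBase b)) (sym eq)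
            (proj₂ (R-orbitIndex (leftBase b)) (orbit-refl (leftBase b))))))
        to : ∀ {i} → (∃ λ a → (IsRep ∩ (_≢ 0#)) a × i ≡ orbitIndex (leftBase a)) → IsLeft F H X i
        to (a , (_ , a≢0) , refl) =
          left-distinct a≢0 (proj₂ (R-orbitIndex (leftBase a)) (orbit-refl (leftBase a))) ,
          a , a≢0 , R-orbitIndex (leftBase a)
        from : ∀ {i} → IsLeft F H X i → ∃ λ a → (IsRep ∩ (_≢ 0#)) a × i ≡ orbitIndex (leftBase a)
        from (_ , a , a≢0 , R≐left) = rep a , (rep-isRep a , rep≢0 a≢0) ,
          orbitIndex-unique (proj₂ R≐left (leftBase⇐ a≢0 (rep-conjugate a))) (orbit-refl (leftBase (rep a)))

      -- Without 0 there remain k + 1 representatives for the second family; without 1 as well, k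
      -- for the first. The families are disjoint and exhaust the nontrivial relations.
      relation-cards : ∀ {c} → HasCard IsRep c → ∃ λ k → c ≡ suc (suc k) ×
        HasCard Nontrivial (k ℕ.+ suc k) × HasCard (IsUpper F H X) k × HasCard (Remaining F H X) (suc k)
      relation-cards reps with card-delete _≟_ 0-isRep reps
      ... | _ , refl , reps≢0 with card-delete _≟_ (1-isRep , 0≢1 ∘ sym) reps≢0
      ... | k , refl , reps≢0,1 = k , refl , card-≐ (to , from) (card-∪ (λ upper rem → proj₂ rem upper) uppers remaining) , uppers , remaining
        where
        uppers : HasCard (IsUpper F H X) k
        uppers = upper-card reps≢0,1
        remaining : HasCard (Remaining F H X) (suc k)
        remaining = card-≐ (proj₂ remaining≐left , proj₁ remaining≐left) (left-card reps≢0)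
        to : ∀ {i} → (IsUpper F H X ∪ Remaining F H X) i → Nontrivial i
        to (inj₁ upper) = proj₁ upper
        to (inj₂ rem)   = proj₁ rem
        from : ∀ {i} → Nontrivial i → (IsUpper F H X ∪ Remaining F H X) i
        from = Sum.map₂ (proj₂ remaining≐left) ∘ upper⊎left

-- From counts in ℕ to the rational formulas

module Rationals where

  open import Data.Integer as ℤ using (+_)
  import Data.Integer.Properties as ℤ
  open import Data.Nat as ℕ using (ℕ; suc; NonZero)
  import Data.Nat.Properties as ℕ
  open import Data.Rational using (toℚᵘ; _+_; _*_; _/_)
  open import Data.Rational.Properties using (toℚᵘ-injective; toℚᵘ-fromℚᵘ; toℚᵘ-homo-+; toℚᵘ-homo-*)
  open import Data.Rational.Unnormalised as ℚᵘ using (mkℚᵘ; *≡*)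
  import Data.Rational.Unnormalised.Properties as ℚᵘ
  open import Relation.Binary.PropositionalEquality

  -- A quotient in ℚ is stored in lowest terms. Moving to unnormalised fractions turns each identity
  -- into a cross-multiplication of integers.
  toℚᵘ-/ : ∀ i d → toℚᵘ (i / suc d) ℚᵘ.≃ mkℚᵘ i d
  toℚᵘ-/ i d = toℚᵘ-fromℚᵘ (mkℚᵘ i d)

  /1-+ : ∀ i j → i / 1 + j / 1 ≡ (i ℤ.+ j) / 1
  /1-+ i j = toℚᵘ-injective (begin
    toℚᵘ (i / 1 + j / 1)             ≈⟨ toℚᵘ-homo-+ (i / 1) (j / 1) ⟩
    toℚᵘ (i / 1) ℚᵘ.+ toℚᵘ (j / 1)   ≈⟨ ℚᵘ.+-cong (toℚᵘ-/ i 0) (toℚᵘ-/ j 0) ⟩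
    mkℚᵘ i 0 ℚᵘ.+ mkℚᵘ j 0           ≈⟨ *≡* (cong (ℤ._* + 1) (cong₂ ℤ._+_ (ℤ.*-identityʳ i) (ℤ.*-identityʳ j))) ⟩
    mkℚᵘ (i ℤ.+ j) 0                 ≈⟨ toℚᵘ-/ (i ℤ.+ j) 0 ⟨
    toℚᵘ ((i ℤ.+ j) / 1)             ∎)
    where open ℚᵘ.≃-Reasoning

  /-*-/1 : ∀ a b c d .{{_ : NonZero b}} → a ℕ.* c ≡ d ℕ.* b → + a / b * (+ c / 1) ≡ + d / 1
  /-*-/1 a (suc b) c d eq = toℚᵘ-injective (begin
    toℚᵘ (+ a / suc b * (+ c / 1))             ≈⟨ toℚᵘ-homo-* (+ a / suc b) (+ c / 1) ⟩
    toℚᵘ (+ a / suc b) ℚᵘ.* toℚᵘ (+ c / 1)     ≈⟨ ℚᵘ.*-cong (toℚᵘ-/ (+ a) b) (toℚᵘ-/ (+ c) 0) ⟩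
    mkℚᵘ (+ a) b ℚᵘ.* mkℚᵘ (+ c) 0             ≈⟨ *≡* cross ⟩
    mkℚᵘ (+ d) 0                               ≈⟨ toℚᵘ-/ (+ d) 0 ⟨
    toℚᵘ (+ d / 1)                             ∎)
    where
    open ℚᵘ.≃-Reasoning
    cross : + a ℤ.* + c ℤ.* + 1 ≡ + d ℤ.* + (suc b ℕ.* 1)
    cross = trans (ℤ.*-identityʳ (+ a ℤ.* + c)) (trans (sym (ℤ.pos-* a c)) (trans (cong +_ eq)
      (trans (ℤ.pos-* d (suc b)) (cong (λ e → + d ℤ.* + e) (sym (ℕ.*-identityʳ (suc b)))))))

  module Counts (ω α d S k : ℕ) .{{_ : NonZero α}} (α≡dω : α ≡ d ℕ.* ω) (S≡ : S ≡ suc (suc k) ℕ.* d) where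
    open ≡-Reasoning

    -- ω/α is 1/d and Burnside's total S is the number of orbits times d, so the mean number of
    -- fixed points is the number k + 2 of orbits.
    mean : + ω / α * (+ S / 1) ≡ + suc (suc k) / 1
    mean = /-*-/1 ω α S (suc (suc k)) (begin
      ω ℕ.* S                    ≡⟨ cong (ω ℕ.*_) S≡ ⟩
      ω ℕ.* (suc (suc k) ℕ.* d)  ≡⟨ ℕ.*-comm ω _ ⟩
      suc (suc k) ℕ.* d ℕ.* ω    ≡⟨ ℕ.*-assoc (suc (suc k)) d ω ⟩
      suc (suc k) ℕ.* (d ℕ.* ω)  ≡⟨ cong (suc (suc k) ℕ.*_) α≡dω ⟨
      suc (suc k) ℕ.* α          ∎)

    upper-count : + k / 1 ≡ (ℤ.- + 2) / 1 + + ω / α * (+ S / 1)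
    upper-count = sym (trans (cong (λ r → (ℤ.- + 2) / 1 + r) mean) (/1-+ (ℤ.- + 2) (+ suc (suc k))))

    left-count : + suc k / 1 ≡ (ℤ.- + 1) / 1 + + ω / α * (+ S / 1)
    left-count = sym (trans (cong (λ r → (ℤ.- + 1) / 1 + r) mean) (/1-+ (ℤ.- + 1) (+ suc (suc k))))

    nontrivial-count : + (k ℕ.+ suc k) / 1 ≡ (ℤ.- + 3) / 1 + + 2 / 1 * (+ ω / α * (+ S / 1))
    nontrivial-count = sym (begin
      (ℤ.- + 3) / 1 + + 2 / 1 * (+ ω / α * (+ S / 1))       ≡⟨ cong (λ r → (ℤ.- + 3) / 1 + + 2 / 1 * r) mean ⟩
      (ℤ.- + 3) / 1 + + 2 / 1 * (+ suc (suc k) / 1)         ≡⟨ cong (λ r → (ℤ.- + 3) / 1 + r) (/-*-/1 2 1 (suc (suc k)) (2 ℕ.* suc (suc k)) (sym (ℕ.*-identityʳ (2 ℕ.* suc (suc k))))) ⟩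
      (ℤ.- + 3) / 1 + + (2 ℕ.* suc (suc k)) / 1             ≡⟨ cong (λ j → (ℤ.- + 3) / 1 + + j / 1) double ⟩
      (ℤ.- + 3) / 1 + + (3 ℕ.+ (k ℕ.+ suc k)) / 1           ≡⟨ /1-+ (ℤ.- + 3) (+ (3 ℕ.+ (k ℕ.+ suc k))) ⟩
      + (k ℕ.+ suc k) / 1                                   ∎)
      where
      -- Twice the number of orbits is split as 3 + (2k + 1), so that -3 cancels by computation.
      double : 2 ℕ.* suc (suc k) ≡ 3 ℕ.+ (k ℕ.+ suc k)
      double = cong (λ j → suc (suc j)) (trans (cong (k ℕ.+_) (ℕ.+-identityʳ (suc (suc k)))) (ℕ.+-suc k (suc k)))

-- Valencies as degrees, and the counts as numbers of Frobenius orbits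

module GaloisScheme where

  open Counting
  open import Defs
  open Frobenius using (module GaloisGroup)
  open Rationals using (module Counts)
  open Plane using (module AffinePlane)
  open Scheme using (module Relations)
  import Data.Integer as ℤ
  open import Data.List using (applyUpTo; map)
  open import Data.Nat using (ℕ; suc; NonZero; _+_; _*_; _^_)
  open import Data.Nat.GCD using (gcd)
  open import Data.Nat.ListAction using (sum)
  open import Data.Nat.Primality using (Prime)
  open import Data.Product using (∃; _×_; _,_)
  import Data.Rational as ℚ
  open import Relation.Binary.PropositionalEquality using (_≡_; _≢_; refl; sym; trans; cong)
  open import Relation.Unary using (U)

  module _ (F : Field) {p : ℕ} (p-prime : Prime p) (ω d : ℕ) .{{_ : NonZero ω}} .{{_ : NonZero d}}
           (F-card : HasCard {Field.Carrier F} U ((p ^ ω) ^ d))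
           (K : Subfield F) (K-card : HasCard (Subfield.Member K) (p ^ ω)) where
    open Field F using (Carrier; 0#)
    open GaloisGroup F p-prime ω d F-card K K-card
    open AffinePlane F _≟_ K using (Conjugate; upper-third-valency; left-third-valency)

    conjugate⇒∼ : ∀ {a b} → Conjugate a b → a ∼ b
    conjugate⇒∼ (φ , φ∈H , refl) = Gal⇒∼ φ∈H _

    ∼⇒conjugate : ∀ {a b} → a ∼ b → Conjugate a b
    ∼⇒conjugate (j , eq) = iter j , iter-∈Gal j , sym eq

    -- The degree of `minimalPolynomial a` is by construction the period of a under σ, which is the
    -- size that `conjugates-card` gives.
    conjugate-card : ∀ a → HasCard (Conjugate a) (MinimalPolynomial.degree (minimalPolynomial a))
    conjugate-card a = card-≐ (∼⇒conjugate , conjugate⇒∼) (conjugates-card a)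

    upper-valency : ∀ a → ∃ λ (f : MinimalPolynomial F K a) →
                    HasThirdValency (upperR F (Gal F K) a) (MinimalPolynomial.degree f)
    upper-valency a = minimalPolynomial a , upper-third-valency (conjugate-card a)

    left-valency : ∀ {n} → HasCard {Carrier} U n → ∀ a → a ≢ 0# → ∃ λ (f : MinimalPolynomial F K a) →
                   HasThirdValency (leftR F (Gal F K) a) (n * MinimalPolynomial.degree f)
    left-valency U-card a a≢0 = minimalPolynomial a , left-third-valency a≢0 U-card (conjugate-card a)

    module _ (X : AST (V F 2)) (obtained : X ObtainedFrom ASL F (Gal F K) 2) where
      open Relations F _≟_ K X obtained using (remaining≐left; relation-cards) public

      private
        S : ℕ
        S = sum (map (λ β → (p ^ ω) ^ gcd d β) (applyUpTo suc d))

        orbit-counts : ∃ λ k → S ≡ suc (suc k) * d × HasCard (AST.Nontrivial X) (k + suc k) ×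
                       HasCard (IsUpper F (Gal F K) X) k × HasCard (Remaining F (Gal F K) X) (suc k)
        orbit-counts =
          let c , reps , total = burnside σᵈ≡id (λ β → (p ^ ω) ^ gcd d β) (λ β → iter-gcd-fixed-card (suc β))
              k , c≡ , cards = relation-cards (IsRepresentative σᵈ≡id) (representative σᵈ≡id)
                (λ a → sym (representative-cong σᵈ≡id (∼-representative σᵈ≡id a)))
                (λ a → ∼⇒conjugate (∼-representative σᵈ≡id a))
                (λ ra rb conj → representative-unique σᵈ≡id ra rb (conjugate⇒∼ conj)) reps
          in k , trans total (cong (_* d) c≡) , cards

      relation-counts : ∀ α .{{_ : NonZero α}} → α ≡ d * ω → let N = (ℤ.+ ω ℚ./ α) ℚ.* (ℤ.+ S ℚ./ 1) in
        (∃ λ c → HasCard (AST.Nontrivial X) c × ℤ.+ c ℚ./ 1 ≡ ((ℤ.- (ℤ.+ 3)) ℚ./ 1) ℚ.+ (ℤ.+ 2 ℚ./ 1) ℚ.* N) ×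
        (∃ λ c → HasCard (IsUpper F (Gal F K) X) c × ℤ.+ c ℚ./ 1 ≡ ((ℤ.- (ℤ.+ 2)) ℚ./ 1) ℚ.+ N) ×
        (∃ λ c → HasCard (Remaining F (Gal F K) X) c × ℤ.+ c ℚ./ 1 ≡ ((ℤ.- (ℤ.+ 1)) ℚ./ 1) ℚ.+ N)
      relation-counts α α≡dω = assemble orbit-counts
        where
        assemble : (∃ λ k → S ≡ suc (suc k) * d × HasCard (AST.Nontrivial X) (k + suc k) ×
                    HasCard (IsUpper F (Gal F K) X) k × HasCard (Remaining F (Gal F K) X) (suc k)) → _
        assemble (k , S≡ , nontrivials , uppers , remaining) =
          (k + suc k , nontrivials , nontrivial-count) , (k , uppers , upper-count) , (suc k , remaining , left-count)
          where open Counts ω α d S k α≡dω S≡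

open import Data.Integer using (+_; -_)
open import Data.List using (applyUpTo; map; sum)
open import Data.Nat using (ℕ; suc; NonZero; _*_; _^_; ≢-nonZero; ≢-nonZero⁻¹)
open import Data.Nat.Divisibility using (_∣_)
open import Data.Nat.DivMod using (_/_; m/n*n≡m)
open import Data.Nat.GCD using (gcd)
open import Data.Nat.Primality using (Prime)
open import Data.Product using (∃; _×_; _,_; proj₁; proj₂)
open import Data.Rational using () renaming (_+_ to _+ℚ_; _*_ to _*ℚ_; _/_ to _/ℚ_)
open import Relation.Binary.PropositionalEquality using (_≡_; _≢_; sym; trans; cong; subst)
open import Relation.Unary using (U; _≐_)

open GaloisScheme using (upper-valency; left-valency; remaining≐left; relation-counts)
open import Data.Nat.Properties using (*-comm; ^-*-assoc)

theorem3p2 :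
    (p α ω : ℕ) .{{_ : NonZero α}} .{{_ : NonZero ω}} → Prime p → ω ∣ α →
    let n = p ^ α
        q = p ^ ω
        N = (+ ω /ℚ α) *ℚ
            (+ sum (map (λ β → q ^ gcd (α / ω) β) (applyUpTo suc (α / ω))) /ℚ 1)
    in
    (F : Field) → HasCard {Field.Carrier F} U n →
    (K : Subfield F) → HasCard (Subfield.Member K) q →
    let 0F = Field.0# F
        1F = Field.1# F
        H = Gal F K
    in
    (X : AST (V F 2)) → X ObtainedFrom ASL F H 2 →
    (∃ λ c → HasCard (AST.Nontrivial X) c ×
      + c /ℚ 1 ≡ (- (+ 3) /ℚ 1) +ℚ (+ 2 /ℚ 1) *ℚ N) ×
    (∃ λ c → HasCard (IsUpper F H X) c ×
      + c /ℚ 1 ≡ (- (+ 2) /ℚ 1) +ℚ N) ×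
    (∀ a → a ≢ 0F → a ≢ 1F → ∃ λ (f : MinimalPolynomial F K a) →
      HasThirdValency (upperR F H a) (MinimalPolynomial.degree f)) ×
    (∃ λ c → HasCard (Remaining F H X) c ×
      + c /ℚ 1 ≡ (- (+ 1) /ℚ 1) +ℚ N) ×
    (Remaining F H X ≐ IsLeft F H X) ×
    (∀ a → a ≢ 0F → ∃ λ (f : MinimalPolynomial F K a) →
      HasThirdValency (leftR F H a) (n * MinimalPolynomial.degree f))
theorem3p2 p α ω p-prime ω∣α F F-card K K-card X obtained =
  proj₁ counts , proj₁ (proj₂ counts) ,
  (λ a _ _ → upper-valency F p-prime ω d F-card′ K K-card a) ,
  proj₂ (proj₂ counts) ,
  remaining≐left F p-prime ω d F-card′ K K-card X obtained ,
  left-valency F p-prime ω d F-card′ K K-card F-card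
  where
  d = α / ω

  α≡dω : α ≡ d * ω
  α≡dω = sym (m/n*n≡m ω∣α)

  instance
    d≢0 : NonZero d
    d≢0 = ≢-nonZero λ d≡0 → ≢-nonZero⁻¹ α (trans α≡dω (cong (_* ω) d≡0))

  -- The order p^α is rewritten as q^d, the form from which Fermat's theorem yields σᵈ = id.
  F-card′ : HasCard U ((p ^ ω) ^ d)
  F-card′ = subst (HasCard U) (trans (cong (p ^_) (trans α≡dω (*-comm d ω))) (sym (^-*-assoc p ω d))) F-card

  counts = relation-counts F p-prime ω d F-card′ K K-card X obtained α α≡dω
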